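{- Let $G_1$ and $G_2$ be torsion-free nilpotent groups. If some connected Cayley graph of finite valency on $G_1$ is isomorphic (as a graph) to some Cayley graph on $G_2$, then $G_1 \cong G_2$.
   Context: For a group $G$ and a symmetric subset $S \subseteq G$ (i.e. $S = S^{ -1}$), the Cayley graph $\mathrm{Cay}(G;S)$ has vertex set $G$, with $g$ adjacent to $gs$ for every $g \in G$ and $s \in S$. It is connected iff $S$ generates $G$, and has finite valency iff $S$ is finite. -}

module Defs where

open import Level using (Level; _⊔_)
open import Data.Nat using (ℕ; zero; suc)
open import Data.Product using (Σ; ∃; _×_; _,_)
open import Data.Sum using (_⊎_)
open import Data.Unit.Polymorphic using (⊤)
open import Data.List using (List)
open import Data.List.Relation.Unary.Any using (Any)
open import Relation.Binary.Construct.Closure.ReflexiveTransitive using (Star)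
open import Algebra.Bundles using (Group)
open import Function.Bundles using (Inverse; _⇔_)
open import Algebra.Morphism.Structures using (module GroupMorphisms)

private variable c ℓ c₂ ℓ₂ s s₂ : Level

module GroupNotions (G : Group c ℓ) where
  open Group G

  pow : Carrier → ℕ → Carrier
  pow g zero    = ε
  pow g (suc n) = g ∙ pow g n

  TorsionFree : Set (c ⊔ ℓ)
  TorsionFree = ∀ (g : Carrier) (n : ℕ) → pow g (suc n) ≈ ε → g ≈ ε

  comm : Carrier → Carrier → Carrier
  comm a b = ((a ⁻¹ ∙ b ⁻¹) ∙ a) ∙ b

  data Gen {p} (P : Carrier → Set p) : Carrier → Set (c ⊔ ℓ ⊔ p) where
    base : ∀ {x} → P x → Gen P x
    unit : Gen P ε
    inv  : ∀ {x} → Gen P x → Gen P (x ⁻¹)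
    mul  : ∀ {x y} → Gen P x → Gen P y → Gen P (x ∙ y)
    resp : ∀ {x y} → x ≈ y → Gen P x → Gen P y

  -- lower central series: γ 0 = G (= γ₁ in the usual numbering),
  -- γ (suc i) = [γ i , G]
  γ : ℕ → Carrier → Set (c ⊔ ℓ)
  γ zero    x = ⊤
  γ (suc i) x = Gen (λ z → Σ Carrier λ a → Σ Carrier λ b → γ i a × z ≈ comm a b) x

  Nilpotent : Set (c ⊔ ℓ)
  Nilpotent = ∃ λ (n : ℕ) → ∀ (x : Carrier) → γ n x → x ≈ ε

  record SymmetricSubset (S : Carrier → Set s) : Set (c ⊔ ℓ ⊔ s) where
    field
      respects  : ∀ {x y} → x ≈ y → S x → S y
      symmetric : ∀ {x} → S x → S (x ⁻¹)

  FiniteSubset : (Carrier → Set s) → Set (c ⊔ ℓ ⊔ s)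
  FiniteSubset S = ∃ λ (L : List Carrier) → ∀ x → S x → Any (x ≈_) L

  CayAdj : (Carrier → Set s) → Carrier → Carrier → Set (c ⊔ ℓ ⊔ s)
  CayAdj S g h = Σ Carrier λ t → S t × h ≈ g ∙ t

  Connected : (Carrier → Set s) → Set (c ⊔ ℓ ⊔ s)
  Connected S = ∀ x y → Star (λ a b → a ≈ b ⊎ CayAdj S a b) x y

CayleyIso : (G₁ : Group c ℓ) (G₂ : Group c₂ ℓ₂)
            (S₁ : Group.Carrier G₁ → Set s) (S₂ : Group.Carrier G₂ → Set s₂) →
            Set (c ⊔ ℓ ⊔ c₂ ⊔ ℓ₂ ⊔ s ⊔ s₂)
CayleyIso G₁ G₂ S₁ S₂ =
  Σ (Inverse (Group.setoid G₁) (Group.setoid G₂)) λ φ →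
    ∀ a b → GroupNotions.CayAdj G₁ S₁ a b ⇔
            GroupNotions.CayAdj G₂ S₂ (Inverse.to φ a) (Inverse.to φ b)

GroupIso : (G₁ : Group c ℓ) (G₂ : Group c₂ ℓ₂) → Set (c ⊔ ℓ ⊔ c₂ ⊔ ℓ₂)
GroupIso G₁ G₂ = ∃ λ (f : Group.Carrier G₁ → Group.Carrier G₂) →
  GroupMorphisms.IsGroupIsomorphism (Group.rawGroup G₁) (Group.rawGroup G₂) f

{-# OPTIONS --safe #-}

-- An isomorphism φ of Cayley graphs, normalised to fix ε, is shown to be a group
-- homomorphism by induction on the nilpotency class.  Multiplication by a central z moves
-- every point a bounded distance, so D x = (φ x)⁻¹ φ (z x) takes finitely many values.
-- Descending the upper central series of G₂, suppose D is constant and central modulo a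
-- term of it.  Modulo the next term, D differs from a constant d by a harmonic function:
-- the contributions [d , t] of the generators t cancel because the generating set is
-- symmetric.  By the maximum principle D is constant, and conjugation by d then permutes the
-- finite generating set, which forces d to be central.  Hence φ carries translations by
-- central elements to such translations and descends to G₁/Z(G₁) → G₂/Z(G₂), which is a
-- homomorphism by induction.  The defect (φ g φ x)⁻¹ φ (g x) is thus central and depends
-- only on x Z(G₁); a central factor shifting a finite set of generators into itself is
-- trivial in the absence of torsion, so the defect is constant in x, equal to ε.
--
-- Neither _≈_ nor membership in S is decidable.  The conclusion is however an equation and
-- the hypotheses are geometric implications, so the argument is carried out classically
-- under Friedman's translation K A = (A → R) → R, with R the equation to be proved.

module Submission where

open import Defs
open import Level using (Level; _⊔_)
open import Algebra.Bundles using (Group; AbelianGroup)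
open import Algebra.Structures using (IsGroup)
import Algebra.Definitions.RawMonoid
open import Data.Bool.Base using (Bool; true; false)
open import Data.Fin.Base using (Fin; zero; suc; toℕ)
import Data.Fin.Properties as Fin
open import Data.Fin.Permutation as Perm using (Permutation′; _⟨$⟩ʳ_; _⟨$⟩ˡ_)
open import Data.List.Base using (List; []; _∷_; _++_; concat; foldr; length; map; replicate; tabulate; cartesianProductWith)
import Data.List.Membership.Setoid as Membership
open import Data.List.Membership.Setoid.Properties using (∈-cartesianProductWith⁺)
open import Data.List.Relation.Unary.All as All using (All; []; _∷_)
import Data.List.Relation.Unary.All.Properties as All
open import Data.List.Relation.Unary.Any as Any using (Any; here; there)
import Data.List.Relation.Unary.Any.Properties as Any
open import Data.Nat.Base as ℕ using (ℕ; zero; suc; _∸_)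
open import Data.Nat.GeneralisedArithmetic using (fold)
import Data.Nat.Properties as ℕ
open import Data.Product.Base using (∃; ∃₂; _×_; _,_; proj₁; proj₂)
open import Data.Sum.Base using (_⊎_; inj₁; inj₂)
open import Data.Vec.Base using (Vec; lookup)
open import Function.Base using (_∘_)
open import Relation.Binary.Core using (Rel)
open import Relation.Binary.Structures using (IsEquivalence)
open import Relation.Binary.PropositionalEquality.Core as ≡ using (_≡_)
import Relation.Binary.Reflection as Reflection
import Relation.Binary.Reasoning.Setoid as SetoidReasoning
open import Relation.Binary.Construct.Closure.ReflexiveTransitive using (Star; _◅_) renaming (ε to [])
open import Function.Bundles using (Inverse; Equivalence; mk⇔)
open import Relation.Nullary.Decidable.Core using (yes; no)
open GroupNotions using (TorsionFree; Nilpotent; SymmetricSubset; FiniteSubset; Connected)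

private variable
  a b c ℓ ℓ′ c₂ ℓ₂ : Level

-- A solver for identities in groups

module GroupSolver (G : Group c ℓ) where
  open Group G
  open import Algebra.Properties.Group G
  open SetoidReasoning setoid

  infixl 7 _⊕_
  infix  8 ⊝_

  data Expr (n : ℕ) : Set where
    var : Fin n → Expr n
    _⊕_ : Expr n → Expr n → Expr n
    ⊝_  : Expr n → Expr n
    ∅   : Expr n

  Letter : ℕ → Set
  Letter n = Bool × Fin n

  ⟦_⟧ : ∀ {n} → Expr n → Vec Carrier n → Carrier
  ⟦ var i ⟧ ρ = lookup ρ i
  ⟦ e ⊕ f ⟧ ρ = ⟦ e ⟧ ρ ∙ ⟦ f ⟧ ρ
  ⟦ ⊝ e ⟧   ρ = ⟦ e ⟧ ρ ⁻¹
  ⟦ ∅ ⟧     ρ = ε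

  signed : Bool → Carrier → Carrier
  signed true  x = x
  signed false x = x ⁻¹

  ⟦_⟧ʷ : ∀ {n} → List (Letter n) → Vec Carrier n → Carrier
  ⟦ [] ⟧ʷ          ρ = ε
  ⟦ (b , i) ∷ w ⟧ʷ ρ = signed b (lookup ρ i) ∙ ⟦ w ⟧ʷ ρ

  push : ∀ {n} → Bool → Fin n → List (Letter n) → List (Letter n)
  push b i [] = (b , i) ∷ []
  push b i ((b′ , j) ∷ w) with i Fin.≟ j | b | b′
  ... | yes _ | true  | false = w
  ... | yes _ | false | true  = w
  ... | _     | _     | _     = (b , i) ∷ (b′ , j) ∷ w

  -- These prepend the reduced word of `e`, respectively of its inverse, to the accumulated word
  -- `w`; all cancellation takes place in `push`.
  normal⁺ normal⁻ : ∀ {n} → Expr n → List (Letter n) → List (Letter n)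
  normal⁺ (var i) w = push true i w
  normal⁺ (e ⊕ f) w = normal⁺ e (normal⁺ f w)
  normal⁺ (⊝ e)   w = normal⁻ e w
  normal⁺ ∅       w = w
  normal⁻ (var i) w = push false i w
  normal⁻ (e ⊕ f) w = normal⁻ f (normal⁻ e w)
  normal⁻ (⊝ e)   w = normal⁺ e w
  normal⁻ ∅       w = w

  push-correct : ∀ {n} b (i : Fin n) w ρ → ⟦ push b i w ⟧ʷ ρ ≈ signed b (lookup ρ i) ∙ ⟦ w ⟧ʷ ρ
  push-correct b i [] ρ = refl
  push-correct b i ((b′ , j) ∷ w) ρ with i Fin.≟ j | b | b′
  ... | yes ≡.refl | true  | false = sym (\\-leftDividesˡ _ _)
  ... | yes ≡.refl | false | true  = sym (\\-leftDividesʳ _ _)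
  ... | yes _ | true  | true  = refl
  ... | yes _ | false | false = refl
  ... | no _  | true  | true  = refl
  ... | no _  | true  | false = refl
  ... | no _  | false | true  = refl
  ... | no _  | false | false = refl

  normal⁺-correct : ∀ {n} (e : Expr n) w ρ → ⟦ normal⁺ e w ⟧ʷ ρ ≈ ⟦ e ⟧ ρ ∙ ⟦ w ⟧ʷ ρ
  normal⁻-correct : ∀ {n} (e : Expr n) w ρ → ⟦ normal⁻ e w ⟧ʷ ρ ≈ ⟦ e ⟧ ρ ⁻¹ ∙ ⟦ w ⟧ʷ ρ
  normal⁺-correct (var i) w ρ = push-correct true i w ρ
  normal⁺-correct (e ⊕ f) w ρ = begin
    ⟦ normal⁺ e (normal⁺ f w) ⟧ʷ ρ   ≈⟨ normal⁺-correct e _ ρ ⟩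
    ⟦ e ⟧ ρ ∙ ⟦ normal⁺ f w ⟧ʷ ρ     ≈⟨ ∙-congˡ (normal⁺-correct f w ρ) ⟩
    ⟦ e ⟧ ρ ∙ (⟦ f ⟧ ρ ∙ ⟦ w ⟧ʷ ρ)   ≈⟨ assoc _ _ _ ⟨
    ⟦ e ⟧ ρ ∙ ⟦ f ⟧ ρ ∙ ⟦ w ⟧ʷ ρ     ∎
  normal⁺-correct (⊝ e)   w ρ = normal⁻-correct e w ρ
  normal⁺-correct ∅       w ρ = sym (identityˡ _)
  normal⁻-correct (var i) w ρ = push-correct false i w ρ
  normal⁻-correct (e ⊕ f) w ρ = begin
    ⟦ normal⁻ f (normal⁻ e w) ⟧ʷ ρ            ≈⟨ normal⁻-correct f _ ρ ⟩
    ⟦ f ⟧ ρ ⁻¹ ∙ ⟦ normal⁻ e w ⟧ʷ ρ           ≈⟨ ∙-congˡ (normal⁻-correct e w ρ) ⟩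
    ⟦ f ⟧ ρ ⁻¹ ∙ (⟦ e ⟧ ρ ⁻¹ ∙ ⟦ w ⟧ʷ ρ)      ≈⟨ assoc _ _ _ ⟨
    ⟦ f ⟧ ρ ⁻¹ ∙ ⟦ e ⟧ ρ ⁻¹ ∙ ⟦ w ⟧ʷ ρ        ≈⟨ ∙-congʳ (⁻¹-anti-homo-∙ _ _) ⟨
    (⟦ e ⟧ ρ ∙ ⟦ f ⟧ ρ) ⁻¹ ∙ ⟦ w ⟧ʷ ρ         ∎
  normal⁻-correct (⊝ e)   w ρ =
    trans (normal⁺-correct e w ρ) (∙-congʳ (sym (⁻¹-involutive _)))
  normal⁻-correct ∅       w ρ = sym (trans (∙-congʳ ε⁻¹≈ε) (identityˡ _))

  open Reflection setoid var ⟦_⟧ (λ e → ⟦ normal⁺ e [] ⟧ʷ)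
    (λ e ρ → trans (normal⁺-correct e [] ρ) (identityʳ _)) public
    using (solve; _⊜_)

-- The quotient by the centre

module Centre (G : Group c ℓ) where
  open Group G
  open SetoidReasoning setoid
  open GroupSolver G

  Central : Carrier → Set (c ⊔ ℓ)
  Central z = ∀ g → z ∙ g ≈ g ∙ z

  conj : Carrier → Carrier → Carrier
  conj x g = x ∙ g ∙ x ⁻¹

  conj-congʳ : ∀ x {g h} → g ≈ h → conj x g ≈ conj x h
  conj-congʳ x g≈h = ∙-congʳ (∙-congˡ g≈h)

  conj-∙ : ∀ x y g → conj (x ∙ y) g ≈ conj x (conj y g)
  conj-∙ = solve 3 (λ x y g → x ⊕ y ⊕ g ⊕ ⊝ (x ⊕ y) ⊜ x ⊕ (y ⊕ g ⊕ ⊝ y) ⊕ ⊝ x) refl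

  -- Equality in G/Z(G), encoded through G/Z(G) ≅ Inn(G).
  infix 4 _≈ᶻ_
  _≈ᶻ_ : Rel Carrier (c ⊔ ℓ)
  x ≈ᶻ y = ∀ g → conj x g ≈ conj y g

  ≈⇒≈ᶻ : ∀ {x y} → x ≈ y → x ≈ᶻ y
  ≈⇒≈ᶻ x≈y g = ∙-cong (∙-congʳ x≈y) (⁻¹-cong x≈y)

  ModCentre : Group c (c ⊔ ℓ)
  ModCentre = record
    { _≈_     = _≈ᶻ_
    ; _∙_     = _∙_
    ; ε       = ε
    ; _⁻¹     = _⁻¹
    ; isGroup = record
      { isMonoid = record
        { isSemigroup = record
          { isMagma = record
            { isEquivalence = record
              { refl  = λ _ → refl
              ; sym   = λ p g → sym (p g)
              ; trans = λ p q g → trans (p g) (q g)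
              }
            ; ∙-cong = λ {x} {y} {u} {v} x≈y u≈v g → begin
                conj (x ∙ u) g    ≈⟨ conj-∙ x u g ⟩
                conj x (conj u g) ≈⟨ x≈y _ ⟩
                conj y (conj u g) ≈⟨ conj-congʳ y (u≈v g) ⟩
                conj y (conj v g) ≈⟨ conj-∙ y v g ⟨
                conj (y ∙ v) g    ∎
            }
          ; assoc = λ x y z → ≈⇒≈ᶻ (assoc x y z)
          }
        ; identity = ≈⇒≈ᶻ ∘ identityˡ , ≈⇒≈ᶻ ∘ identityʳ
        }
      ; inverse = ≈⇒≈ᶻ ∘ inverseˡ , ≈⇒≈ᶻ ∘ inverseʳ
      ; ⁻¹-cong = λ {x} {y} x≈y g → begin
          conj (x ⁻¹) g                              ≈⟨ cancelᵐ x y g ⟩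
          conj (x ⁻¹) (conj y (conj (y ⁻¹) g))       ≈⟨ conj-congʳ (x ⁻¹) (x≈y _) ⟨
          conj (x ⁻¹) (conj x (conj (y ⁻¹) g))       ≈⟨ cancelˡ x (conj (y ⁻¹) g) ⟩
          conj (y ⁻¹) g                              ∎
      }
    }
    where
    cancelᵐ : ∀ x y g → conj (x ⁻¹) g ≈ conj (x ⁻¹) (conj y (conj (y ⁻¹) g))
    cancelᵐ = solve 3 (λ x y g → ⊝ x ⊕ g ⊕ ⊝ ⊝ x ⊜
      ⊝ x ⊕ (y ⊕ (⊝ y ⊕ g ⊕ ⊝ ⊝ y) ⊕ ⊝ y) ⊕ ⊝ ⊝ x) refl
    cancelˡ : ∀ x g → conj (x ⁻¹) (conj x g) ≈ g
    cancelˡ = solve 2 (λ x g → ⊝ x ⊕ (x ⊕ g ⊕ ⊝ x) ⊕ ⊝ ⊝ x ⊜ g) refl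

  ≈ᶻ⇒central : ∀ {x y} → x ≈ᶻ y → Central (x ⁻¹ ∙ y)
  ≈ᶻ⇒central {x} {y} x≈y g = begin
    x ⁻¹ ∙ y ∙ g            ≈⟨ solve 3 (λ x y g → ⊝ x ⊕ y ⊕ g ⊜ ⊝ x ⊕ (y ⊕ g ⊕ ⊝ y) ⊕ y) refl x y g ⟩
    x ⁻¹ ∙ conj y g ∙ y     ≈⟨ ∙-congʳ (∙-congˡ (x≈y g)) ⟨
    x ⁻¹ ∙ conj x g ∙ y     ≈⟨ solve 3 (λ x y g → ⊝ x ⊕ (x ⊕ g ⊕ ⊝ x) ⊕ y ⊜ g ⊕ (⊝ x ⊕ y)) refl x y g ⟩
    g ∙ (x ⁻¹ ∙ y)          ∎

  central⇒≈ᶻ : ∀ {x y} → Central (x ⁻¹ ∙ y) → x ≈ᶻ y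
  central⇒≈ᶻ {x} {y} z g = begin
    x ∙ g ∙ x ⁻¹                    ≈⟨ solve 3 (λ x y g → x ⊕ g ⊕ ⊝ x ⊜ x ⊕ (g ⊕ (⊝ x ⊕ y)) ⊕ ⊝ y) refl x y g ⟩
    x ∙ (g ∙ (x ⁻¹ ∙ y)) ∙ y ⁻¹     ≈⟨ ∙-congʳ (∙-congˡ (z g)) ⟨
    x ∙ (x ⁻¹ ∙ y ∙ g) ∙ y ⁻¹       ≈⟨ solve 3 (λ x y g → x ⊕ (⊝ x ⊕ y ⊕ g) ⊕ ⊝ y ⊜ y ⊕ g ⊕ ⊝ y) refl x y g ⟩
    y ∙ g ∙ y ⁻¹                    ∎

  central-resp : ∀ {x y} → x ≈ y → Central x → Central y
  central-resp x≈y z g = trans (∙-congʳ (sym x≈y)) (trans (z g) (∙-congˡ x≈y))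

  central⇒≈ᶻε : ∀ {z} → Central z → ε ≈ᶻ z
  central⇒≈ᶻε {z} cz = central⇒≈ᶻ (central-resp (solve 1 (λ z → z ⊜ ⊝ ∅ ⊕ z) refl z) cz)

  ε-central : Central ε
  ε-central g = trans (identityˡ g) (sym (identityʳ g))

  ∙-central : ∀ {x y} → Central x → Central y → Central (x ∙ y)
  ∙-central {x} {y} cx cy g = begin
    x ∙ y ∙ g     ≈⟨ assoc x y g ⟩
    x ∙ (y ∙ g)   ≈⟨ ∙-congˡ (cy g) ⟩
    x ∙ (g ∙ y)   ≈⟨ assoc x g y ⟨
    x ∙ g ∙ y     ≈⟨ ∙-congʳ (cx g) ⟩
    g ∙ x ∙ y     ≈⟨ assoc g x y ⟩
    g ∙ (x ∙ y)   ∎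

  ⁻¹-central : ∀ {x} → Central x → Central (x ⁻¹)
  ⁻¹-central {x} cx g = begin
    x ⁻¹ ∙ g               ≈⟨ solve 2 (λ x g → ⊝ x ⊕ g ⊜ ⊝ x ⊕ (g ⊕ x) ⊕ ⊝ x) refl x g ⟩
    x ⁻¹ ∙ (g ∙ x) ∙ x ⁻¹  ≈⟨ ∙-congʳ (∙-congˡ (cx g)) ⟨
    x ⁻¹ ∙ (x ∙ g) ∙ x ⁻¹  ≈⟨ solve 2 (λ x g → ⊝ x ⊕ (x ⊕ g) ⊕ ⊝ x ⊜ g ⊕ ⊝ x) refl x g ⟩
    g ∙ x ⁻¹               ∎

  centre : AbelianGroup (c ⊔ ℓ) ℓ
  centre = record
    { Carrier        = ∃ Central
    ; _≈_            = λ x y → proj₁ x ≈ proj₁ y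
    ; _∙_            = λ x y → proj₁ x ∙ proj₁ y , ∙-central (proj₂ x) (proj₂ y)
    ; ε              = ε , ε-central
    ; _⁻¹            = λ x → proj₁ x ⁻¹ , ⁻¹-central (proj₂ x)
    ; isAbelianGroup = record
      { isGroup = record
        { isMonoid = record
          { isSemigroup = record
            { isMagma = record
              { isEquivalence = record { refl = refl ; sym = sym ; trans = trans }
              ; ∙-cong        = ∙-cong
              }
            ; assoc = λ x y z → assoc (proj₁ x) (proj₁ y) (proj₁ z)
            }
          ; identity = identityˡ ∘ proj₁ , identityʳ ∘ proj₁
          }
        ; inverse = inverseˡ ∘ proj₁ , inverseʳ ∘ proj₁
        ; ⁻¹-cong = ⁻¹-cong
        }
      ; comm = λ x y → proj₂ x (proj₁ y)
      }
    }

open Centre using (Central; ModCentre; centre)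

-- The upper central series

-- The upper central series reaches the whole group after `n` terms. Iterating the quotient by the
-- centre makes induction on the class a plain recursion on `n`.
UpperNilpotent : ℕ → Group c ℓ → Set (c ⊔ ℓ)
UpperNilpotent zero    G = ∀ x → Group._≈_ G x (Group.ε G)
UpperNilpotent (suc n) G = UpperNilpotent n (ModCentre G)

upperNilpotent-suc : ∀ n (G : Group c ℓ) → UpperNilpotent n G → UpperNilpotent (suc n) G
upperNilpotent-suc zero    G trivial x = Centre.≈⇒≈ᶻ G (trivial x)
upperNilpotent-suc (suc n) G nilpotent = upperNilpotent-suc n (ModCentre G) nilpotent

-- Serves to bring two groups to a common bound on the class, since the main induction passes to
-- both quotients at once.
upperNilpotent-+ : ∀ m n (G : Group c ℓ) → UpperNilpotent n G → UpperNilpotent (m ℕ.+ n) G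
upperNilpotent-+ zero    n G nilpotent = nilpotent
upperNilpotent-+ (suc m) n G nilpotent = upperNilpotent-suc (m ℕ.+ n) G (upperNilpotent-+ m n G nilpotent)

module _ (G : Group c ℓ) where
  open Group G
  open GroupNotions G using (γ; pow; comm; base; unit; inv; mul; resp)
  open GroupSolver G

  coarsen : {_~_ : Rel Carrier ℓ′} → IsGroup _~_ _∙_ ε _⁻¹ → Group c ℓ′
  coarsen isGroup = record { isGroup = isGroup }

  module _ {_~_ : Rel Carrier ℓ′} (isG : IsGroup _~_ _∙_ ε _⁻¹) where
    private module Q = Group (coarsen isG)

    -- Both groups share carrier and operations, so a derivation for the quotient is replayed with
    -- every entry replaced by a lift. The steps `resp` are absorbed by `y ~ x`.
    γ-coarsen : ∀ i {x} → GroupNotions.γ (coarsen isG) i x → ∃ λ y → γ i y × y ~ x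
    γ-coarsen zero    {x} _ = x , _ , Q.refl
    γ-coarsen (suc i) = lift
      where
      lift : ∀ {x} → GroupNotions.γ (coarsen isG) (suc i) x → ∃ λ y → γ (suc i) y × y ~ x
      lift (base (g , h , γg , x~[g,h])) with g′ , γg′ , g′~g ← γ-coarsen i γg =
        comm g′ h , base (g′ , h , γg′ , refl) ,
        Q.trans (Q.∙-congʳ (Q.∙-cong (Q.∙-congʳ (Q.⁻¹-cong g′~g)) g′~g)) (Q.sym x~[g,h])
      lift unit = ε , unit , Q.refl
      lift (inv p) with y , γy , y~x ← lift p = y ⁻¹ , inv γy , Q.⁻¹-cong y~x
      lift (mul p q) with y , γy , y~x ← lift p | z , γz , z~x′ ← lift q =
        y ∙ z , mul γy γz , Q.∙-cong y~x z~x′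
      lift (resp x~x′ p) with y , γy , y~x ← lift p = y , γy , Q.trans y~x x~x′

  comm≈ε⇒commute : ∀ {x y} → comm x y ≈ ε → x ∙ y ≈ y ∙ x
  comm≈ε⇒commute {x} {y} [x,y]≈ε = begin
    x ∙ y                  ≈⟨ solve 2 (λ x y → x ⊕ y ⊜ y ⊕ x ⊕ (⊝ x ⊕ ⊝ y ⊕ x ⊕ y)) refl x y ⟩
    y ∙ x ∙ comm x y       ≈⟨ ∙-congˡ [x,y]≈ε ⟩
    y ∙ x ∙ ε              ≈⟨ identityʳ _ ⟩
    y ∙ x                  ∎
    where open SetoidReasoning setoid

-- If the term after γ n is trivial, elements of γ n commute with everything. They are thus central,
-- and the n-th term of the lower central series of G/Z(G) vanishes.
γ-trivial⇒upperNilpotent : ∀ n (G : Group c ℓ) → let open Group G in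
  (∀ x → GroupNotions.γ G n x → x ≈ ε) → UpperNilpotent n G
γ-trivial⇒upperNilpotent zero    G γ⇒ε x = γ⇒ε x _
γ-trivial⇒upperNilpotent (suc n) G γ⇒ε =
  γ-trivial⇒upperNilpotent n (ModCentre G) λ x γx →
    let y , γy , y≈ᶻx = γ-coarsen G (Group.isGroup (ModCentre G)) n γx in
    Q.trans (Q.sym y≈ᶻx) (Q.sym (Centre.central⇒≈ᶻε G
      λ g → comm≈ε⇒commute G (γ⇒ε _ (base (y , g , γy , refl)))))
  where
  open Group G
  open GroupNotions using (base)
  module Q = Group (ModCentre G)

-- Torsion in the centre

pow-map : (G : Group c ℓ) (H : Group c₂ ℓ₂) (f : Group.Carrier G → Group.Carrier H) →
  f (Group.ε G) ≡ Group.ε H → (∀ x y → f (Group._∙_ G x y) ≡ Group._∙_ H (f x) (f y)) →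
  ∀ x n → f (GroupNotions.pow G x n) ≡ GroupNotions.pow H (f x) n
pow-map G H f f-ε f-∙ x zero    = f-ε
pow-map G H f f-ε f-∙ x (suc n) =
  ≡.trans (f-∙ x _) (≡.cong (Group._∙_ H (f x)) (pow-map G H f f-ε f-∙ x n))

-- This form of torsion-freeness is inherited by G/Z(G), and it suffices below because the equations
-- from which a multiple is removed are equations between central elements.
TorsionFreeCentre : Group c ℓ → Set (c ⊔ ℓ)
TorsionFreeCentre G = TorsionFree (AbelianGroup.group (centre G))

module _ (G : Group c ℓ) where
  open Group G
  open GroupNotions using (pow)
  open GroupSolver G
  open Centre G using (_≈ᶻ_; ≈ᶻ⇒central; central⇒≈ᶻ; central⇒≈ᶻε; central-resp)
  open SetoidReasoning setoid

  private module Z = AbelianGroup (centre G)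

  torsionFree⇒torsionFreeCentre : TorsionFree G → TorsionFreeCentre G
  torsionFree⇒torsionFreeCentre tf z n zⁿ≈ε =
    tf (proj₁ z) n (trans (reflexive (≡.sym (pow-map Z.group G proj₁ ≡.refl (λ _ _ → ≡.refl) z (suc n)))) zⁿ≈ε)

  module Commutator {d} (d-central : Central (ModCentre G) d) where
    -- The value is [d , h], in the shape ≈ᶻ⇒central delivers.
    κ : Carrier → Z.Carrier
    κ h = (h ∙ d) ⁻¹ ∙ (d ∙ h) , ≈ᶻ⇒central (Group.sym (ModCentre G) (d-central h))

    κ-correct : ∀ h → d ∙ h ≈ h ∙ d ∙ proj₁ (κ h)
    κ-correct h = solve 2 (λ d h → d ⊕ h ⊜ h ⊕ d ⊕ (⊝ (h ⊕ d) ⊕ (d ⊕ h))) refl d h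

    κ-cong : ∀ {h k} → h ≈ k → κ h Z.≈ κ k
    κ-cong h≈k = ∙-cong (⁻¹-cong (∙-congʳ h≈k)) (∙-congˡ h≈k)

    -- In any group [d , hk] = [d , k] [d , h]ᵏ, the last factor being a conjugate by k. Here
    -- [d , h] is central, so the conjugation disappears.
    κ-homo : ∀ h k → κ (h ∙ k) Z.≈ κ h Z.∙ κ k
    κ-homo h k = begin
      (h ∙ k ∙ d) ⁻¹ ∙ (d ∙ (h ∙ k))
        ≈⟨ solve 3 (λ d h k → ⊝ (h ⊕ k ⊕ d) ⊕ (d ⊕ (h ⊕ k)) ⊜
             ⊝ (k ⊕ d) ⊕ (d ⊕ (⊝ (h ⊕ d) ⊕ (d ⊕ h)) ⊕ k)) refl d h k ⟩
      (k ∙ d) ⁻¹ ∙ (d ∙ proj₁ (κ h) ∙ k)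
        ≈⟨ ∙-congˡ (∙-congʳ (proj₂ (κ h) d)) ⟨
      (k ∙ d) ⁻¹ ∙ (proj₁ (κ h) ∙ d ∙ k)
        ≈⟨ ∙-congˡ (assoc _ _ _) ⟩
      (k ∙ d) ⁻¹ ∙ (proj₁ (κ h) ∙ (d ∙ k))
        ≈⟨ assoc _ _ _ ⟨
      (k ∙ d) ⁻¹ ∙ proj₁ (κ h) ∙ (d ∙ k)
        ≈⟨ ∙-congʳ (proj₂ (κ h) _) ⟨
      proj₁ (κ h) ∙ (k ∙ d) ⁻¹ ∙ (d ∙ k)
        ≈⟨ assoc _ _ _ ⟩
      proj₁ (κ h) ∙ ((k ∙ d) ⁻¹ ∙ (d ∙ k)) ∎

    κ≈ε : ∀ {h} → d ∙ h ≈ h ∙ d → κ h Z.≈ Z.ε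
    κ≈ε {h} dh≈hd = begin
      (h ∙ d) ⁻¹ ∙ (d ∙ h)  ≈⟨ ∙-congˡ dh≈hd ⟩
      (h ∙ d) ⁻¹ ∙ (h ∙ d)  ≈⟨ inverseˡ _ ⟩
      ε                     ∎

    -- The elements h and k differ by a central factor, whose commutator with d is trivial.
    κ-≈ᶻ : ∀ {h k} → h ≈ᶻ k → κ h Z.≈ κ k
    κ-≈ᶻ {h} {k} h≈k = begin
      proj₁ (κ h)                          ≈⟨ identityʳ _ ⟨
      proj₁ (κ h) ∙ ε                      ≈⟨ ∙-congˡ (κ≈ε (sym (≈ᶻ⇒central h≈k d))) ⟨
      proj₁ (κ h) ∙ proj₁ (κ (h ⁻¹ ∙ k))   ≈⟨ κ-homo h (h ⁻¹ ∙ k) ⟨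
      proj₁ (κ (h ∙ (h ⁻¹ ∙ k)))           ≈⟨ κ-cong (solve 2 (λ h k → h ⊕ (⊝ h ⊕ k) ⊜ k) refl h k) ⟩
      proj₁ (κ k)                          ∎

    -- That is, [dⁿ , h] = [d , h]ⁿ: every factor d moved past h leaves behind one copy of the
    -- central element [d , h].
    pow-commute : ∀ n h → pow G d n ∙ h ≈ h ∙ (pow G d n ∙ pow G (proj₁ (κ h)) n)
    pow-commute zero    h = solve 1 (λ h → ∅ ⊕ h ⊜ h ⊕ (∅ ⊕ ∅)) refl h
    pow-commute (suc n) h = begin
      d ∙ dⁿ ∙ h                ≈⟨ assoc _ _ _ ⟩
      d ∙ (dⁿ ∙ h)              ≈⟨ ∙-congˡ (pow-commute n h) ⟩
      d ∙ (h ∙ (dⁿ ∙ κⁿ))       ≈⟨ assoc _ _ _ ⟨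
      d ∙ h ∙ (dⁿ ∙ κⁿ)         ≈⟨ ∙-congʳ (κ-correct h) ⟩
      h ∙ d ∙ κ₁ ∙ (dⁿ ∙ κⁿ)    ≈⟨ solve 5 (λ h d κ₁ dⁿ κⁿ → h ⊕ d ⊕ κ₁ ⊕ (dⁿ ⊕ κⁿ) ⊜ h ⊕ (d ⊕ (κ₁ ⊕ dⁿ) ⊕ κⁿ)) refl h d κ₁ dⁿ κⁿ ⟩
      h ∙ (d ∙ (κ₁ ∙ dⁿ) ∙ κⁿ)  ≈⟨ ∙-congˡ (∙-congʳ (∙-congˡ (proj₂ (κ h) dⁿ))) ⟩
      h ∙ (d ∙ (dⁿ ∙ κ₁) ∙ κⁿ)  ≈⟨ solve 5 (λ h d κ₁ dⁿ κⁿ → h ⊕ (d ⊕ (dⁿ ⊕ κ₁) ⊕ κⁿ) ⊜ h ⊕ (d ⊕ dⁿ ⊕ (κ₁ ⊕ κⁿ))) refl h d κ₁ dⁿ κⁿ ⟩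
      h ∙ (d ∙ dⁿ ∙ (κ₁ ∙ κⁿ))  ∎
      where
      dⁿ = pow G d n
      κ₁ = proj₁ (κ h)
      κⁿ = pow G κ₁ n

  -- If a positive power dⁿ of d in the second centre is central, then [d , h]ⁿ = [dⁿ , h] = ε. As
  -- [d , h] is central it is trivial, so d is itself central.
  torsionFreeCentre-modCentre : TorsionFreeCentre G → TorsionFreeCentre (ModCentre G)
  torsionFreeCentre-modCentre tf (d , d-central) n dⁿ≈ᶻε =
    Group.sym (ModCentre G) (central⇒≈ᶻε λ h → begin
      d ∙ h                  ≈⟨ κ-correct h ⟩
      h ∙ d ∙ proj₁ (κ h)    ≈⟨ ∙-congˡ (tf (κ h) n (κⁿ≈ε h)) ⟩
      h ∙ d ∙ ε              ≈⟨ identityʳ _ ⟩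
      h ∙ d                  ∎)
    where
    open Commutator d-central
    dⁿ = pow G d (suc n)

    dⁿ-central : Central G dⁿ
    dⁿ-central = central-resp
      (trans (solve 1 (λ x → ⊝ ∅ ⊕ x ⊜ x) refl _) (reflexive (pow-map (AbelianGroup.group (centre (ModCentre G))) G proj₁ ≡.refl (λ _ _ → ≡.refl)
         (d , d-central) (suc n))))
      (≈ᶻ⇒central (Group.sym (ModCentre G) dⁿ≈ᶻε))

    κⁿ≈ε : ∀ h → pow Z.group (κ h) (suc n) Z.≈ Z.ε
    κⁿ≈ε h = begin
      proj₁ (pow Z.group (κ h) (suc n))  ≡⟨ pow-map Z.group G proj₁ ≡.refl (λ _ _ → ≡.refl) (κ h) (suc n) ⟩
      κⁿ                                 ≈⟨ solve 3 (λ h dⁿ κⁿ → κⁿ ⊜ ⊝ dⁿ ⊕ ⊝ h ⊕ (h ⊕ (dⁿ ⊕ κⁿ))) refl h dⁿ κⁿ ⟩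
      dⁿ ⁻¹ ∙ h ⁻¹ ∙ (h ∙ (dⁿ ∙ κⁿ))     ≈⟨ ∙-congˡ (pow-commute (suc n) h) ⟨
      dⁿ ⁻¹ ∙ h ⁻¹ ∙ (dⁿ ∙ h)            ≈⟨ ∙-congˡ (dⁿ-central h) ⟩
      dⁿ ⁻¹ ∙ h ⁻¹ ∙ (h ∙ dⁿ)            ≈⟨ solve 2 (λ h dⁿ → ⊝ dⁿ ⊕ ⊝ h ⊕ (h ⊕ dⁿ) ⊜ ∅) refl h dⁿ ⟩
      ε                                  ∎
      where κⁿ = pow G (proj₁ (κ h)) (suc n)

pow≡× : ∀ (G : Group c ℓ) g n →
  GroupNotions.pow G g n ≡ Algebra.Definitions.RawMonoid._×_ (Group.rawMonoid G) n g
pow≡× G g zero    = ≡.refl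
pow≡× G g (suc n) = ≡.cong (Group._∙_ G g) (pow≡× G g n)

-- The maximum principle

module Relative {r} (R : Set r) where

  K : Set a → Set (a ⊔ r)
  K A = (A → R) → R

  private variable
    X : Set a
    Y : Set b

  pure : X → K X
  pure x k = k x

  abort : R → K X
  abort x _ = x

  _>>=_ : K X → (X → K Y) → K Y
  (m >>= f) k = m λ x → f x k

  -- The negation of `X` is `X → R`. The continuation is first given a refutation; applying that
  -- refutation to a proof of `X` re-enters the same continuation.
  excludedMiddle : ∀ (X : Set a) → K (X ⊎ (X → R))
  excludedMiddle X k = k (inj₂ (k ∘ inj₁))

  finiteChoice : ∀ {n} {P : Fin n → Set a} → (∀ i → K (P i)) → K (∀ i → P i)
  finiteChoice {n = zero}  m = pure λ ()
  finiteChoice {n = suc n} m = do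
    p  ← m zero
    ps ← finiteChoice (m ∘ suc)
    pure λ { zero → p ; (suc i) → ps i }

  StableEquality : Group c ℓ → Set (c ⊔ ℓ ⊔ r)
  StableEquality G = ∀ {x y} → K (x ≈ y) → x ≈ y
    where open Group G

  -- Averages and extreme points in abelian groups

  module AbelianLemmas (A : AbelianGroup a ℓ) where
    open AbelianGroup A
    open GroupSolver group
    open SetoidReasoning setoid
    open import Algebra.Properties.CommutativeSemigroup commutativeSemigroup using (interchange)
    open import Algebra.Properties.CommutativeMonoid.Mult commutativeMonoid
      using (×-homo-+; ×-distrib-+; ×-congʳ; ×-assocˡ; ×-cong) renaming (_×_ to _·_)
    open import Algebra.Properties.CommutativeMonoid.Sum commutativeMonoid
      using (sum; sum-cong-≋; sum-permute; ∑-distrib-+; sum-replicate; sum-replicate-zero)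
    open import Algebra.Properties.Group group using (x∙y⁻¹≈ε⇒x≈y)
    open Membership setoid using (_∈_)

    -- Σ (b − a) in additive notation: it vanishes iff a is the average of the list.
    excess : Carrier → List Carrier → Carrier
    excess a = foldr (λ b s → b ∙ a ⁻¹ ∙ s) ε

    -- An extreme point of F, which takes the place of a maximum without any choice of an order: `a`
    -- is an average of elements of F only in the trivial way. Repetitions in `bs` act as weights.
    Extreme : Carrier → List Carrier → Set _
    Extreme a F = ∀ bs → All (_∈ F) bs → excess a bs ≈ ε → K (All (_≈ a) bs)

    excess-++ : ∀ a bs cs → excess a (bs ++ cs) ≈ excess a bs ∙ excess a cs
    excess-++ a []       cs = sym (identityˡ _)
    excess-++ a (b ∷ bs) cs = trans (∙-congˡ (excess-++ a bs cs)) (sym (assoc _ _ _))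

    excess-copies : ∀ a n bs → excess a (concat (replicate n bs)) ≈ n · excess a bs
    excess-copies a zero    bs = refl
    excess-copies a (suc n) bs = trans (excess-++ a bs _) (∙-congˡ (excess-copies a n bs))

    excess-shift : ∀ a f bs → excess a bs ≈ excess f bs ∙ length bs · (f ∙ a ⁻¹)
    excess-shift a f []       = sym (identityˡ _)
    excess-shift a f (b ∷ bs) = begin
      b ∙ a ⁻¹ ∙ excess a bs
        ≈⟨ ∙-cong (solve 3 (λ a f b → b ⊕ ⊝ a ⊜ b ⊕ ⊝ f ⊕ (f ⊕ ⊝ a)) refl a f b) (excess-shift a f bs) ⟩
      b ∙ f ⁻¹ ∙ (f ∙ a ⁻¹) ∙ (excess f bs ∙ length bs · (f ∙ a ⁻¹))
        ≈⟨ interchange _ _ _ _ ⟩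
      b ∙ f ⁻¹ ∙ excess f bs ∙ (f ∙ a ⁻¹ ∙ length bs · (f ∙ a ⁻¹)) ∎

    excess-constant : ∀ a bs → All (_≈ a) bs → excess a bs ≈ ε
    excess-constant a []       []         = refl
    excess-constant a (b ∷ bs) (b≈a ∷ ps) = begin
      b ∙ a ⁻¹ ∙ excess a bs  ≈⟨ ∙-cong (∙-congʳ b≈a) (excess-constant a bs ps) ⟩
      a ∙ a ⁻¹ ∙ ε            ≈⟨ solve 1 (λ a → a ⊕ ⊝ a ⊕ ∅ ⊜ ∅) refl a ⟩
      ε                       ∎

    excess-tabulate : ∀ {n} a (f : Fin n → Carrier) → excess a (tabulate f) ≈ sum (λ i → f i ∙ a ⁻¹)
    excess-tabulate {zero}  a f = refl
    excess-tabulate {suc n} a f = ∙-congˡ (excess-tabulate a (f ∘ suc))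

    -- Separates occurrences of `f` from the rest by the membership proofs, as equality cannot be
    -- decided. The alternative `copies ≡ 0` covers lists in which no occurrence of `f` was
    -- recorded.
    record Split (f : Carrier) (F bs : List Carrier) : Set (a ⊔ ℓ) where
      field
        copies : ℕ
        rest   : List Carrier
        rest∈F : All (_∈ F) rest
        excess-split : ∀ a → excess a bs ≈ copies · (f ∙ a ⁻¹) ∙ excess a rest
        all-split : ∀ {a} → (copies ≡ 0 ⊎ f ≈ a) → All (_≈ a) rest → All (_≈ a) bs

    split : ∀ f F bs → All (_∈ f ∷ F) bs → Split f F bs
    split f F [] [] = record
      { copies = 0 ; rest = [] ; rest∈F = []
      ; excess-split = λ a → sym (identityˡ ε) ; all-split = λ _ _ → [] }
    split f F (b ∷ bs) (here b≈f ∷ bs∈) = record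
      { copies = suc copies ; rest = rest ; rest∈F = rest∈F
      ; excess-split = λ a → begin
          b ∙ a ⁻¹ ∙ excess a bs                                    ≈⟨ ∙-cong (∙-congʳ b≈f) (excess-split a) ⟩
          f ∙ a ⁻¹ ∙ (copies · (f ∙ a ⁻¹) ∙ excess a rest)          ≈⟨ assoc _ _ _ ⟨
          f ∙ a ⁻¹ ∙ copies · (f ∙ a ⁻¹) ∙ excess a rest            ∎
      ; all-split = λ { (inj₂ f≈a) ps → trans b≈f f≈a ∷ all-split (inj₂ f≈a) ps } }
      where open Split (split f F bs bs∈)
    split f F (b ∷ bs) (there b∈F ∷ bs∈) = record
      { copies = copies ; rest = b ∷ rest ; rest∈F = b∈F ∷ rest∈F
      ; excess-split = λ a → begin
          b ∙ a ⁻¹ ∙ excess a bs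
            ≈⟨ ∙-congˡ (excess-split a) ⟩
          b ∙ a ⁻¹ ∙ (copies · (f ∙ a ⁻¹) ∙ excess a rest)
            ≈⟨ assoc _ _ _ ⟨
          b ∙ a ⁻¹ ∙ copies · (f ∙ a ⁻¹) ∙ excess a rest
            ≈⟨ ∙-congʳ (comm _ _) ⟩
          copies · (f ∙ a ⁻¹) ∙ (b ∙ a ⁻¹) ∙ excess a rest
            ≈⟨ assoc _ _ _ ⟩
          copies · (f ∙ a ⁻¹) ∙ (b ∙ a ⁻¹ ∙ excess a rest) ∎
      ; all-split = λ { f≈a (p ∷ ps) → p ∷ all-split f≈a ps } }
      where open Split (split f F bs bs∈)

    module _ (stable : StableEquality group) (torsionFree : TorsionFree group) where

      ·-torsionFree : ∀ n {x} → suc n · x ≈ ε → x ≈ ε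
      ·-torsionFree n {x} nx≈ε =
        torsionFree x n (trans (reflexive (pow≡× group x (suc n))) nx≈ε)

      -- If f is already an average of elements of F, adding it creates no new averages.
      extreme-∷-average : ∀ {a f F} c cs → All (_∈ F) (c ∷ cs) → excess f (c ∷ cs) ≈ ε →
                          Extreme a F → Extreme a (f ∷ F)
      extreme-∷-average {a} {f} {F} c cs′ cs∈F f-average extreme bs bs∈ bs-average = do
        -- In m copies of `bs`, every m occurrences of `f` are traded for one copy of `cs`, whose
        -- average is `f`. The resulting list lies in F and still averages to `a`.
        all-a ← extreme (concat (replicate copies cs) ++ concat (replicate m rest))
                  (All.++⁺ (All.concat⁺ (All.replicate⁺ copies cs∈F)) (All.concat⁺ (All.replicate⁺ m rest∈F)))
                  average
        -- Since `cs` is nonempty, `m` is a successor and a first copy of `rest` is present.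
        let rest≈a = All.head (All.concat⁻ {xss = replicate m rest} (All.++⁻ʳ (concat (replicate copies cs)) all-a))
        pure (all-split (f≈a copies (All.concat⁻ {xss = replicate copies cs} (All.++⁻ˡ _ all-a))) rest≈a)
        where
        open Split (split f F bs bs∈)
        cs = c ∷ cs′
        m = length cs

        excess-cs : excess a cs ≈ m · (f ∙ a ⁻¹)
        excess-cs = begin
          excess a cs                     ≈⟨ excess-shift a f cs ⟩
          excess f cs ∙ m · (f ∙ a ⁻¹)    ≈⟨ ∙-congʳ f-average ⟩
          ε ∙ m · (f ∙ a ⁻¹)              ≈⟨ identityˡ _ ⟩
          m · (f ∙ a ⁻¹)                  ∎

        average : excess a (concat (replicate copies cs) ++ concat (replicate m rest)) ≈ ε
        average = begin
          excess a (concat (replicate copies cs) ++ concat (replicate m rest))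
            ≈⟨ excess-++ a (concat (replicate copies cs)) _ ⟩
          excess a (concat (replicate copies cs)) ∙ excess a (concat (replicate m rest))
            ≈⟨ ∙-cong (excess-copies a copies cs) (excess-copies a m rest) ⟩
          copies · excess a cs ∙ m · excess a rest
            ≈⟨ ∙-congʳ (×-congʳ copies excess-cs) ⟩
          copies · (m · (f ∙ a ⁻¹)) ∙ m · excess a rest
            ≈⟨ ∙-congʳ (trans (×-assocˡ _ copies m) (trans (×-cong (ℕ.*-comm copies m) refl) (sym (×-assocˡ _ m copies)))) ⟩
          m · (copies · (f ∙ a ⁻¹)) ∙ m · excess a rest
            ≈⟨ ×-distrib-+ _ _ m ⟨
          m · (copies · (f ∙ a ⁻¹) ∙ excess a rest)
            ≈⟨ ×-congʳ m (trans (sym (excess-split a)) bs-average) ⟩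
          m · ε
            ≈⟨ sum-replicate m ⟨
          sum {m} (λ _ → ε)
            ≈⟨ sum-replicate-zero m ⟩
          ε ∎

        -- If `f` occurs, so does a copy of `cs`, all of whose entries are `a`. Then m (f - a) = 0,
        -- and torsion-freeness gives f = a.
        f≈a : ∀ n → All (All (_≈ a)) (replicate n cs) → n ≡ 0 ⊎ f ≈ a
        f≈a zero    _           = inj₁ ≡.refl
        f≈a (suc n) (cs≈a ∷ _)  = inj₂ (x∙y⁻¹≈ε⇒x≈y f a
          (·-torsionFree (length cs′) (trans (sym excess-cs) (excess-constant a cs cs≈a))))

      -- Induction on the list: if `f` is an average of the other elements it may be discarded, and
      -- otherwise `f` itself is extreme.
      extreme-exists : ∀ f F → K (∃ λ a → a ∈ f ∷ F × Extreme a (f ∷ F))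
      extreme-exists f F = do
        inj₁ (c , cs , cs∈F , f-average) ← excludedMiddle
          (∃₂ λ c cs → All (_∈ F) (c ∷ cs) × excess f (c ∷ cs) ≈ ε)
          where inj₂ f-no-average → pure (f , here refl , f-extreme f-no-average)
        extend F cs∈F f-average
        where
        extend : ∀ F {c cs} → All (_∈ F) (c ∷ cs) → excess f (c ∷ cs) ≈ ε →
                 K (∃ λ a → a ∈ f ∷ F × Extreme a (f ∷ F))
        extend []       (() ∷ _) _
        extend (f′ ∷ F) {c} {cs} cs∈F f-average = do
          a , a∈F , a-extreme ← extreme-exists f′ F
          pure (a , there a∈F , extreme-∷-average c cs cs∈F f-average a-extreme)

        f-extreme : ((∃₂ λ c cs → All (_∈ F) (c ∷ cs) × excess f (c ∷ cs) ≈ ε) → R) → Extreme f (f ∷ F)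
        f-extreme f-no-average bs bs∈ bs-average = conclude rest rest∈F excess-rest (all-split (inj₂ refl))
          where
          open Split (split f F bs bs∈)
          excess-rest : excess f rest ≈ ε
          excess-rest = begin
            excess f rest                               ≈⟨ identityˡ _ ⟨
            ε ∙ excess f rest                           ≈⟨ ∙-congʳ (sum-replicate-zero copies) ⟨
            sum {copies} (λ _ → ε) ∙ excess f rest      ≈⟨ ∙-congʳ (sum-replicate copies) ⟩
            copies · ε ∙ excess f rest                  ≈⟨ ∙-congʳ (×-congʳ copies (inverseʳ f)) ⟨
            copies · (f ∙ f ⁻¹) ∙ excess f rest         ≈⟨ excess-split f ⟨
            excess f bs                                 ≈⟨ bs-average ⟩
            ε                                           ∎
          -- A nonempty remainder would exhibit `f` as an average of elements of F, contrary to
          -- assumption.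
          conclude : ∀ rs → All (_∈ F) rs → excess f rs ≈ ε → (All (_≈ f) rs → All (_≈ f) bs) →
                     K (All (_≈ f) bs)
          conclude []       _    _     all-bs = pure (all-bs [])
          conclude (c ∷ cs) c∈F f-average _   = abort (f-no-average (c , cs , c∈F , f-average))

      -- Adding the sum to its reindexing by `ι` gives Σ (f i + f (ι i)) = 0, so twice the sum
      -- vanishes. The argument 1 of `·-torsionFree` stands for multiplication by 2.
      odd-sum≈ε : ∀ {n} (f : Fin n → Carrier) (ι : Permutation′ n) →
                  (∀ i → f i ∙ f (ι ⟨$⟩ʳ i) ≈ ε) → sum f ≈ ε
      odd-sum≈ε {n} f ι odd = ·-torsionFree 1 (begin
        sum f ∙ (sum f ∙ ε)                          ≈⟨ ∙-congˡ (identityʳ _) ⟩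
        sum f ∙ sum f                                ≈⟨ ∙-congˡ (sum-permute f ι) ⟩
        sum f ∙ sum (λ i → f (ι ⟨$⟩ʳ i))             ≈⟨ ∑-distrib-+ f _ ⟨
        sum (λ i → f i ∙ f (ι ⟨$⟩ʳ i))               ≈⟨ sum-cong-≋ odd ⟩
        sum {n} (λ _ → ε)                            ≈⟨ sum-replicate-zero n ⟩
        ε                                            ∎)

      -- Choose an extreme point among the finitely many values of `e`. Where it is attained,
      -- harmonicity makes it the average of the neighbouring values, which must therefore all equal
      -- it.
      maximumPrinciple : ∀ {n} (e : X → Carrier) (next : X → Fin n → X) →
        (∀ x → sum (λ i → e (next x i) ∙ e x ⁻¹) ≈ ε) →
        ∀ xs → (∀ x → K (Any (λ y → e x ≈ e y) xs)) → X →
        K (∃ λ y → ∀ x → e x ≈ e y → ∀ i → e (next x i) ≈ e y)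
      maximumPrinciple {X = X} {n} e next harmonic xs covers x₀ = do
        -- The cover of `x₀` shows that the list of values is nonempty.
        cover₀ ← covers x₀
        a , a∈ , a-extreme ← extremeValue xs cover₀
        let y , a≈ey = Any.satisfied (Any.map⁻ a∈)
        pure (y , λ x ex≈ey i → stable (do
          ∈values ← finiteChoice (covers ∘ next x)
          all-a ← a-extreme (tabulate (e ∘ next x))
            (All.tabulate⁺ (λ j → Any.map⁺ (∈values j)))
            (begin
              excess a (tabulate (e ∘ next x))             ≈⟨ excess-tabulate a (e ∘ next x) ⟩
              sum (λ j → e (next x j) ∙ a ⁻¹)              ≈⟨ sum-cong-≋ (λ j → ∙-congˡ {e (next x j)} (⁻¹-cong (trans a≈ey (sym ex≈ey)))) ⟩
              sum (λ j → e (next x j) ∙ e x ⁻¹)            ≈⟨ harmonic x ⟩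
              ε                                            ∎)
          pure (trans (All.tabulate⁻ all-a i) a≈ey)))
        where
        extremeValue : ∀ xs {P : X → Set ℓ} → Any P xs → K (∃ λ a → a ∈ map e xs × Extreme a (map e xs))
        extremeValue (x ∷ xs) _ = extreme-exists (e x) (map e xs)

  -- Equivariant maps from a Cayley graph to a group

  -- Equivalent members receive propositionally equal representatives. Hence, for congruence modulo
  -- the centre, they can be substituted inside equations of the group itself.
  representatives : {_~_ : Rel X b} → IsEquivalence _~_ → ∀ {n} (t : Fin n → X) →
    K (∃ λ (rep : Fin n → X) → (∀ i → rep i ~ t i) × (∀ i j → t i ~ t j → K (rep i ≡ rep j)))
  representatives equiv {zero}  t = pure (t , (λ ()) , λ ())
  representatives {_~_ = _~_} equiv {suc n} t = do
    rep , rep~t , rep-unique ← representatives equiv (t ∘ suc)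
    inj₁ (j , t₀~tⱼ) ← excludedMiddle (∃ λ j → t zero ~ t (suc j))
      where inj₂ new → pure
              ( (λ { zero → t zero ; (suc i) → rep i })
              , (λ { zero → ~.refl ; (suc i) → rep~t i })
              , λ { zero    zero    _     → pure ≡.refl
                  ; zero    (suc j) t₀~tⱼ → abort (new (j , t₀~tⱼ))
                  ; (suc i) zero    tᵢ~t₀ → abort (new (i , ~.sym tᵢ~t₀))
                  ; (suc i) (suc j) tᵢ~tⱼ → rep-unique i j tᵢ~tⱼ })
    pure
      ( (λ { zero → rep j ; (suc i) → rep i })
      , (λ { zero → ~.trans (rep~t j) (~.sym t₀~tⱼ) ; (suc i) → rep~t i })
      , λ { zero    zero    _     → pure ≡.refl
          ; zero    (suc i) t₀~tᵢ → rep-unique j i (~.trans (~.sym t₀~tⱼ) t₀~tᵢ)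
          ; (suc i) zero    tᵢ~t₀ → rep-unique i j (~.trans tᵢ~t₀ t₀~tⱼ)
          ; (suc i) (suc j) tᵢ~tⱼ → rep-unique i j tᵢ~tⱼ })
    where module ~ = IsEquivalence equiv

  -- Standing hypotheses and generating families

  record Tame (n : ℕ) (G : Group c ℓ) : Set (c ⊔ ℓ ⊔ r) where
    field
      stable            : StableEquality G
      torsionFreeCentre : TorsionFreeCentre G
      upperNilpotent    : UpperNilpotent n G

  tame-modCentre : ∀ {n} {G : Group c ℓ} → Tame (suc n) G → Tame n (ModCentre G)
  tame-modCentre {G = G} tame = record
    { stable            = λ p g → stable (p >>= λ x≈y → pure (x≈y g))
    ; torsionFreeCentre = torsionFreeCentre-modCentre G torsionFreeCentre
    ; upperNilpotent    = upperNilpotent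
    }
    where open Tame tame

  -- The head of the list is the last letter, so `i ∷ w` extends the walk `w` by one edge.
  word : (G : Group c ℓ) → let open Group G in ∀ {k} → (Fin k → Carrier) → List (Fin k) → Carrier
  word G gen = foldr (λ i x → x ∙ gen i) ε
    where open Group G

  -- A symmetric generating family with multiplicities: `gen` need not be injective, so it survives
  -- passage to G/Z(G), where distinct generators may coincide.
  record Generators (k : ℕ) (G : Group c ℓ) : Set (c ⊔ ℓ ⊔ r) where
    open Group G
    field
      gen       : Fin k → Carrier
      opp       : Permutation′ k
      gen-opp   : ∀ i → gen (opp ⟨$⟩ʳ i) ≈ gen i ⁻¹
      generates : ∀ x → K (∃ λ w → x ≈ word G gen w)

    walk : {P : Carrier → Set a} → (∀ {x y} → x ≈ y → P x → P y) →
           ∀ {x₀} → P x₀ → (∀ x i → P x → P (x ∙ gen i)) → ∀ x → K (P x)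
    walk {P = P} P-resp {x₀} start step x = do
      w , x₀⁻¹x≈w ← generates (x₀ ⁻¹ ∙ x)
      pure (P-resp (trans (∙-congˡ (sym x₀⁻¹x≈w)) (\\-leftDividesˡ x₀ x)) (along w))
      where
      open import Algebra.Properties.Group G using (\\-leftDividesˡ)
      along : ∀ w → P (x₀ ∙ word G gen w)
      along []      = P-resp (sym (identityʳ _)) start
      along (i ∷ w) = P-resp (assoc _ _ _) (step _ i (along w))

  generators-modCentre : ∀ {k} {G : Group c ℓ} → Generators k G → Generators k (ModCentre G)
  generators-modCentre {G = G} S = record
    { gen       = gen
    ; opp       = opp
    ; gen-opp   = λ i → ≈⇒≈ᶻ (gen-opp i)
    ; generates = λ x → generates x >>= λ (w , x≈w) → pure (w , ≈⇒≈ᶻ x≈w)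
    }
    where
    open Generators S
    open Centre G using (≈⇒≈ᶻ)

  -- Finite families shifted by central elements

  module CentralLemmas (G : Group c ℓ) (stable : StableEquality G) (torsionFreeCentre : TorsionFreeCentre G) where
    open Group G
    open GroupSolver G
    open SetoidReasoning setoid
    open Centre G using (_≈ᶻ_; ≈ᶻ⇒central)
    private module Z = AbelianGroup (centre G)
    open AbelianLemmas (centre G) using (·-torsionFree)
    open import Algebra.Properties.CommutativeMonoid.Mult Z.commutativeMonoid
      using (×-homo-+) renaming (_×_ to _·_)
    open import Algebra.Properties.CommutativeMonoid.Sum Z.commutativeMonoid
      using (sum; sum-cong-≋; sum-permute; ∑-distrib-+)
    open import Algebra.Properties.Group Z.group using () renaming (∙-cancelˡ to Z-cancelˡ; ∙-cancelʳ to Z-cancelʳ)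
    open import Algebra.Properties.Group G using (∙-cancelˡ)

    -- Iterating σ multiplies t j by the powers of δ j, and Fin k is finite.
    centralShift-trivial : ∀ {k} (t : Fin k → Carrier) (σ : Fin k → Fin k) (δ : Fin k → Z.Carrier) →
      (∀ j → t (σ j) ≈ t j ∙ proj₁ (δ j)) → (∀ j → δ (σ j) Z.≈ δ j) → ∀ j → δ j Z.≈ Z.ε
    centralShift-trivial {k} t σ δ shift δ-invariant j
      with p , q , p<q , σᵖ≡σ^q ← Fin.pigeonhole (ℕ.n<1+n k) (λ p → fold j σ (toℕ p)) =
      -- From σᵖ j = σ^q j with p < q, the power of `δ j` with exponent q - p is trivial. The
      -- argument is q - p - 1 because `·-torsionFree` adds one.
      ·-torsionFree stable torsionFreeCentre (toℕ q ∸ suc (toℕ p)) (Z-cancelˡ (toℕ p · δ j) (n · δ j) Z.ε (begin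
        proj₁ (toℕ p · δ j Z.∙ n · δ j)        ≈⟨ ×-homo-+ (δ j) (toℕ p) n ⟨
        proj₁ ((toℕ p ℕ.+ n) · δ j)            ≡⟨ ≡.cong (λ m → proj₁ (m · δ j)) p+n≡q ⟩
        proj₁ (toℕ q · δ j)                    ≈⟨ ∙-cancelˡ (t j) _ _ (begin
          t j ∙ proj₁ (toℕ q · δ j)              ≈⟨ t-iterate (toℕ q) ⟨
          t (fold j σ (toℕ q))                   ≡⟨ ≡.cong t σᵖ≡σ^q ⟨
          t (fold j σ (toℕ p))                   ≈⟨ t-iterate (toℕ p) ⟩
          t j ∙ proj₁ (toℕ p · δ j)              ∎) ⟩
        proj₁ (toℕ p · δ j)                    ≈⟨ identityʳ _ ⟨
        proj₁ (toℕ p · δ j Z.∙ Z.ε)            ∎))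
      where
      n = suc (toℕ q ∸ suc (toℕ p))
      p+n≡q : toℕ p ℕ.+ n ≡ toℕ q
      p+n≡q = ≡.trans (ℕ.+-suc (toℕ p) _) (ℕ.m+[n∸m]≡n p<q)

      δ-iterate : ∀ m → δ (fold j σ m) Z.≈ δ j
      δ-iterate zero    = refl
      δ-iterate (suc m) = trans (δ-invariant (fold j σ m)) (δ-iterate m)

      t-iterate : ∀ m → t (fold j σ m) ≈ t j ∙ proj₁ (m · δ j)
      t-iterate zero    = sym (identityʳ _)
      t-iterate (suc m) = begin
        t (σ (fold j σ m))                               ≈⟨ shift (fold j σ m) ⟩
        t (fold j σ m) ∙ proj₁ (δ (fold j σ m))          ≈⟨ ∙-cong (t-iterate m) (δ-iterate m) ⟩
        t j ∙ proj₁ (m · δ j) ∙ proj₁ (δ j)              ≈⟨ assoc _ _ _ ⟩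
        t j ∙ (proj₁ (m · δ j) ∙ proj₁ (δ j))            ≈⟨ ∙-congˡ (proj₂ (δ j) _) ⟨
        t j ∙ (proj₁ (δ j) ∙ proj₁ (m · δ j))            ∎

    -- With common representatives of classes modulo the centre, put ζ i = (rep i)⁻¹ t i.
    -- Additively, each quotient is ζ (π i) - ζ (ρ i), and both terms have the same sum over i.
    permutedQuotients-sum : ∀ {k} (t : Fin k → Carrier) (ρ π : Permutation′ k)
      (t∘ρ≈t∘π : ∀ i → t (ρ ⟨$⟩ʳ i) ≈ᶻ t (π ⟨$⟩ʳ i)) →
      sum (λ i → t (ρ ⟨$⟩ʳ i) ⁻¹ ∙ t (π ⟨$⟩ʳ i) , ≈ᶻ⇒central (t∘ρ≈t∘π i)) Z.≈ Z.ε
    permutedQuotients-sum {k} t ρ π t∘ρ≈t∘π = stable (do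
      rep , rep≈t , rep-unique ← representatives (Group.isEquivalence (ModCentre G)) t
      let ζ = λ i → rep i ⁻¹ ∙ t i , ≈ᶻ⇒central (rep≈t i)
      pure (Z-cancelʳ (sum ζ) (sum quotient) Z.ε (begin
        proj₁ (sum quotient Z.∙ sum ζ)
          ≈⟨ ∙-congˡ (sum-permute ζ ρ) ⟩
        proj₁ (sum quotient Z.∙ sum (λ i → ζ (ρ ⟨$⟩ʳ i)))
          ≈⟨ ∑-distrib-+ quotient _ ⟨
        proj₁ (sum (λ i → quotient i Z.∙ ζ (ρ ⟨$⟩ʳ i)))
          ≈⟨ sum-cong-≋ {k} (λ i → begin
               t (ρ ⟨$⟩ʳ i) ⁻¹ ∙ t (π ⟨$⟩ʳ i) ∙ (rep (ρ ⟨$⟩ʳ i) ⁻¹ ∙ t (ρ ⟨$⟩ʳ i))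
                 ≈⟨ proj₂ (quotient i) _ ⟩
               rep (ρ ⟨$⟩ʳ i) ⁻¹ ∙ t (ρ ⟨$⟩ʳ i) ∙ (t (ρ ⟨$⟩ʳ i) ⁻¹ ∙ t (π ⟨$⟩ʳ i))
                 ≈⟨ solve 3 (λ u v w → ⊝ u ⊕ v ⊕ (⊝ v ⊕ w) ⊜ ⊝ u ⊕ w) refl _ _ _ ⟩
               rep (ρ ⟨$⟩ʳ i) ⁻¹ ∙ t (π ⟨$⟩ʳ i)
                 ≈⟨ ∙-congʳ (⁻¹-cong (stable (rep-unique _ _ (t∘ρ≈t∘π i) >>= λ eq → pure (reflexive eq)))) ⟩
               rep (π ⟨$⟩ʳ i) ⁻¹ ∙ t (π ⟨$⟩ʳ i) ∎) ⟩
        proj₁ (sum (λ i → ζ (π ⟨$⟩ʳ i)))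
          ≈⟨ sum-permute ζ π ⟨
        proj₁ (sum ζ)
          ≈⟨ identityˡ _ ⟨
        proj₁ (Z.ε Z.∙ sum ζ) ∎)))
      where
      quotient : Fin k → Z.Carrier
      quotient i = t (ρ ⟨$⟩ʳ i) ⁻¹ ∙ t (π ⟨$⟩ʳ i) , ≈ᶻ⇒central (t∘ρ≈t∘π i)

  -- Satisfied by D x = (φ x)⁻¹ φ′ x for two graph isomorphisms φ and φ′, where
  -- φ (x sᵢ) = φ x t_{ρ i} and φ′ (x sᵢ) = φ′ x t_{π i}.
  record Equivariant {k} {G : Group c ℓ} {H : Group c₂ ℓ₂} (S : Generators k G) (T : Generators k H)
                     (D : Group.Carrier G → Group.Carrier H) : Set (c ⊔ ℓ ⊔ c₂ ⊔ ℓ₂ ⊔ r) where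
    private
      module G = Group G
      module H = Group H
      module S = Generators S
      module T = Generators T
    field
      cong : ∀ {x y} → x G.≈ y → D x H.≈ D y
      step : ∀ x → K (∃₂ λ (ρ π : Permutation′ k) → ∀ i →
        T.gen (ρ ⟨$⟩ʳ i) H.∙ D (x G.∙ S.gen i) H.≈ D x H.∙ T.gen (π ⟨$⟩ʳ i))

  -- Finiteness is witnessed by points rather than values, so one list serves `D` modulo every term
  -- of the upper central series as well as the functions derived from `D`.
  FinitelyValued : {G : Group c ℓ} (H : Group c₂ ℓ₂) → (Group.Carrier G → Group.Carrier H) → Set _
  FinitelyValued {G = G} H D = ∃ λ xs → ∀ x → K (Any (λ y → Group._≈_ H (D x) (D y)) xs)

  -- Descent by one term of the upper central series

  module _ {k} {G : Group c ℓ} {H : Group c₂ ℓ₂} (S : Generators k G) (T : Generators k H)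
           (H-stable : StableEquality H) (H-torsionFree : TorsionFreeCentre H)
           {D : Group.Carrier G → Group.Carrier H} (D-equivariant : Equivariant S T D)
           (D-finite : FinitelyValued {G = G} H D)
           (D-const : ∀ x → Centre._≈ᶻ_ H (D x) (D (Group.ε G)))
           (D-central : Central (ModCentre H) (D (Group.ε G))) where
    private
      module G = Group G
      module S = Generators S
      module D = Equivariant D-equivariant
      d = D G.ε
    open Group H
    open Generators T renaming (gen to t)
    open Centre H using (_≈ᶻ_; ≈ᶻ⇒central; ≈⇒≈ᶻ)
    open Commutator H D-central
    open GroupSolver H
    open SetoidReasoning setoid
    private module Z = AbelianGroup (centre H)
    open import Algebra.Properties.CommutativeMonoid.Sum Z.commutativeMonoid
      using (sum; sum-cong-≋; sum-permute; ∑-distrib-+)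
    open AbelianLemmas (centre H)
    open CentralLemmas H H-stable H-torsionFree
    private
      module Q = Group (ModCentre H)

      centre-stable : StableEquality Z.group
      centre-stable = H-stable

      e : G.Carrier → Z.Carrier
      e x = d ⁻¹ ∙ D x , ≈ᶻ⇒central (Q.sym (D-const x))

      module AtVertex {x} {ρ π : Permutation′ k}
        (step : ∀ i → t (ρ ⟨$⟩ʳ i) ∙ D (x G.∙ S.gen i) ≈ D x ∙ t (π ⟨$⟩ʳ i)) where

        -- Modulo the centre, `D` is the constant d and d is central, so d cancels from the step
        -- equation.
        t∘ρ≈t∘π : ∀ i → t (ρ ⟨$⟩ʳ i) ≈ᶻ t (π ⟨$⟩ʳ i)
        t∘ρ≈t∘π i = Q-cancelʳ d _ _ (Q.trans (Q.∙-congˡ (Q.sym (D-const (x G.∙ S.gen i))))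
          (Q.trans (≈⇒≈ᶻ (step i)) (Q.trans (Q.∙-congʳ (D-const x)) (D-central _))))
          where open import Algebra.Properties.Group (ModCentre H) using () renaming (∙-cancelʳ to Q-cancelʳ)

        quotient : Fin k → Z.Carrier
        quotient i = t (ρ ⟨$⟩ʳ i) ⁻¹ ∙ t (π ⟨$⟩ʳ i) , ≈ᶻ⇒central (t∘ρ≈t∘π i)

        e-step : ∀ i → e (x G.∙ S.gen i) Z.∙ e x Z.⁻¹ Z.≈ κ (t (ρ ⟨$⟩ʳ i)) Z.∙ quotient i
        e-step i = begin
          d ⁻¹ ∙ D (x G.∙ S.gen i) ∙ e₁ ⁻¹
            ≈⟨ ∙-congʳ (solve 3 (λ d u v → ⊝ d ⊕ v ⊜ ⊝ d ⊕ ⊝ u ⊕ (u ⊕ v)) refl d tρ _) ⟩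
          d ⁻¹ ∙ tρ ⁻¹ ∙ (tρ ∙ D (x G.∙ S.gen i)) ∙ e₁ ⁻¹
            ≈⟨ ∙-congʳ (∙-congˡ (step i)) ⟩
          d ⁻¹ ∙ tρ ⁻¹ ∙ (D x ∙ tπ) ∙ e₁ ⁻¹
            ≈⟨ ∙-congʳ (solve 4 (λ d u v w → ⊝ d ⊕ ⊝ u ⊕ (v ⊕ w) ⊜ ⊝ d ⊕ ⊝ u ⊕ d ⊕ (⊝ d ⊕ v ⊕ w)) refl d tρ _ tπ) ⟩
          d ⁻¹ ∙ tρ ⁻¹ ∙ d ∙ (e₁ ∙ tπ) ∙ e₁ ⁻¹
            ≈⟨ ∙-congʳ (∙-congˡ (proj₂ (e x) tπ)) ⟩
          d ⁻¹ ∙ tρ ⁻¹ ∙ d ∙ (tπ ∙ e₁) ∙ e₁ ⁻¹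
            ≈⟨ solve 4 (λ d u w z → ⊝ d ⊕ ⊝ u ⊕ d ⊕ (w ⊕ z) ⊕ ⊝ z ⊜ ⊝ (u ⊕ d) ⊕ (d ⊕ u) ⊕ (⊝ u ⊕ w)) refl d tρ tπ e₁ ⟩
          (tρ ∙ d) ⁻¹ ∙ (d ∙ tρ) ∙ (tρ ⁻¹ ∙ tπ) ∎
          where
          e₁ = proj₁ (e x)
          tρ = t (ρ ⟨$⟩ʳ i)
          tπ = t (π ⟨$⟩ʳ i)

        κ-sum : sum (κ ∘ t) Z.≈ Z.ε
        κ-sum = odd-sum≈ε (λ {x} {y} → centre-stable {x} {y}) H-torsionFree (κ ∘ t) opp λ i → begin
          proj₁ (κ (t i) Z.∙ κ (t (opp ⟨$⟩ʳ i)))   ≈⟨ κ-homo (t i) (t (opp ⟨$⟩ʳ i)) ⟨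
          proj₁ (κ (t i ∙ t (opp ⟨$⟩ʳ i)))         ≈⟨ κ-cong (trans (∙-congˡ (gen-opp i)) (inverseʳ _)) ⟩
          proj₁ (κ ε)                              ≈⟨ κ≈ε (trans (identityʳ d) (sym (identityˡ d))) ⟩
          ε                                        ∎

        -- The increments of `e` are products of [d , t (ρ i)] and a quotient. The commutators sum
        -- to zero since inverse generators contribute opposite values; the quotients cancel by
        -- reindexing.
        e-harmonic : sum (λ i → e (x G.∙ S.gen i) Z.∙ e x Z.⁻¹) Z.≈ Z.ε
        e-harmonic = begin
          proj₁ (sum (λ i → e (x G.∙ S.gen i) Z.∙ e x Z.⁻¹))                  ≈⟨ sum-cong-≋ e-step ⟩
          proj₁ (sum (λ i → κ (t (ρ ⟨$⟩ʳ i)) Z.∙ quotient i))                 ≈⟨ ∑-distrib-+ _ quotient ⟩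
          proj₁ (sum (λ i → κ (t (ρ ⟨$⟩ʳ i))) Z.∙ sum quotient)               ≈⟨ ∙-congʳ (sum-permute (κ ∘ t) ρ) ⟨
          proj₁ (sum (κ ∘ t) Z.∙ sum quotient)                                ≈⟨ ∙-cong κ-sum (permutedQuotients-sum t ρ π t∘ρ≈t∘π) ⟩
          ε ∙ ε                                                               ≈⟨ identityˡ ε ⟩
          ε                                                                   ∎

    -- An extreme value of the harmonic function `e` propagates along edges, and the generators
    -- reach every vertex, so `e` is constant.
    descend-const : ∀ x → D x ≈ d
    descend-const x = H-stable (do
      y , max ← maximumPrinciple (λ {x} {y} → centre-stable {x} {y}) H-torsionFree e (λ x i → x G.∙ S.gen i)
        (λ x → H-stable (D.step x >>= λ (ρ , π , st) → pure (AtVertex.e-harmonic {x} {ρ} {π} st)))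
        (proj₁ D-finite)
        (λ x → proj₂ D-finite x >>= λ p → pure (Any.map ∙-congˡ p))
        G.ε
      let walk-e = S.walk {P = λ x → e x Z.≈ e y} (λ u≈v → trans (∙-congˡ (D.cong (G.sym u≈v)))) {y} refl
                     (λ x i ex≈ey → max x ex≈ey i)
      ex≈ey ← walk-e x
      eε≈ey ← walk-e G.ε
      pure (∙-cancelˡ (d ⁻¹) _ _ (trans ex≈ey (sym eε≈ey))))
      where
      open import Algebra.Properties.Group H using (∙-cancelˡ)

    descend-central : Central H d
    descend-central h = H-stable (do
      ρ , π , step ← D.step G.ε
      walk {P = λ h → d ∙ h ≈ h ∙ d} (λ u≈v p → trans (∙-congˡ (sym u≈v)) (trans p (∙-congʳ u≈v)))
        {ε} (trans (identityʳ d) (sym (identityˡ d)))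
        (λ h i dh≈hd → begin
           d ∙ (h ∙ t i)    ≈⟨ assoc d h (t i) ⟨
           d ∙ h ∙ t i      ≈⟨ ∙-congʳ dh≈hd ⟩
           h ∙ d ∙ t i      ≈⟨ assoc h d (t i) ⟩
           h ∙ (d ∙ t i)    ≈⟨ ∙-congˡ (commutes {ρ} {π} step i) ⟩
           h ∙ (t i ∙ d)    ≈⟨ assoc h (t i) d ⟨
           h ∙ t i ∙ d      ∎)
        h)
      where
      commutes : ∀ {ρ π : Permutation′ k} →
        (∀ i → t (ρ ⟨$⟩ʳ i) ∙ D (G.ε G.∙ S.gen i) ≈ D G.ε ∙ t (π ⟨$⟩ʳ i)) → ∀ i → d ∙ t i ≈ t i ∙ d
      commutes {ρ} {π} step i = begin
        d ∙ t i                      ≈⟨ κ-correct (t i) ⟩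
        t i ∙ d ∙ proj₁ (κ (t i))    ≈⟨ ∙-congˡ (Z-⁻¹-injective {κ (t i)} {Z.ε} (trans (δ-trivial i) (sym Z-ε⁻¹≈ε))) ⟩
        t i ∙ d ∙ ε                  ≈⟨ identityʳ _ ⟩
        t i ∙ d                      ∎
        where
        open import Algebra.Properties.Group Z.group using () renaming (⁻¹-injective to Z-⁻¹-injective; ε⁻¹≈ε to Z-ε⁻¹≈ε)
        open AtVertex {G.ε} {ρ} {π} step
        -- As `D` is now known to be constant, conjugation by d sends t j to t (σ j), a shift by the
        -- central element [t j , d]. This depends only on t j modulo the centre, hence is invariant
        -- under σ, and iterating σ makes it trivial.
        σ : Fin k → Fin k
        σ j = π ⟨$⟩ʳ (ρ ⟨$⟩ˡ j)

        t-σ : ∀ j → t j ∙ d ≈ d ∙ t (σ j)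
        t-σ j = begin
          t j ∙ d                                              ≡⟨ ≡.cong (λ i → t i ∙ d) (Perm.inverseʳ ρ) ⟨
          t (ρ ⟨$⟩ʳ (ρ ⟨$⟩ˡ j)) ∙ d                            ≈⟨ ∙-congˡ (descend-const _) ⟨
          t (ρ ⟨$⟩ʳ (ρ ⟨$⟩ˡ j)) ∙ D (G.ε G.∙ S.gen (ρ ⟨$⟩ˡ j)) ≈⟨ step (ρ ⟨$⟩ˡ j) ⟩
          d ∙ t (σ j)                                          ∎

        tσ≈t : ∀ j → t (σ j) ≈ᶻ t j
        tσ≈t j = Q.trans (Q.sym (t∘ρ≈t∘π (ρ ⟨$⟩ˡ j))) (Q.reflexive (≡.cong t (Perm.inverseʳ ρ)))

        δ-trivial : ∀ j → κ (t j) Z.⁻¹ Z.≈ Z.ε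
        δ-trivial = centralShift-trivial t σ (λ j → κ (t j) Z.⁻¹)
          (λ j → begin
            t (σ j)                                    ≈⟨ solve 2 (λ d u → u ⊜ ⊝ d ⊕ (d ⊕ u)) refl d (t (σ j)) ⟩
            d ⁻¹ ∙ (d ∙ t (σ j))                       ≈⟨ ∙-congˡ (t-σ j) ⟨
            d ⁻¹ ∙ (t j ∙ d)                           ≈⟨ solve 2 (λ d u → ⊝ d ⊕ (u ⊕ d) ⊜ u ⊕ ⊝ (⊝ (u ⊕ d) ⊕ (d ⊕ u))) refl d (t j) ⟩
            t j ∙ ((t j ∙ d) ⁻¹ ∙ (d ∙ t j)) ⁻¹        ∎)
          (λ j → ⁻¹-cong (κ-≈ᶻ (tσ≈t j)))

  -- Induction on the class of H, with G fixed: equivariance and finiteness persist modulo Z(H), so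
  -- the induction hypothesis supplies constancy and centrality there.
  equivariant⇒constant : ∀ n {k} {G : Group c ℓ} {H : Group c₂ ℓ₂} (S : Generators k G) (T : Generators k H) →
    Tame n H → ∀ {D} → Equivariant S T D → FinitelyValued {G = G} H D →
    (∀ x → Group._≈_ H (D x) (D (Group.ε G))) × Central H (D (Group.ε G))
  equivariant⇒constant zero {H = H} S T tame _ _ =
    (λ x → trans (trivial _) (sym (trivial _))) , λ h → trans (trivial _) (sym (trivial _))
    where
    open Group H
    trivial = Tame.upperNilpotent tame
  equivariant⇒constant (suc n) {G = G} {H = H} S T tame {D} D-equivariant (xs , covers) =
    descend-const S T stable torsionFreeCentre D-equivariant (xs , covers) (proj₁ modCentre) (proj₂ modCentre) ,
    descend-central S T stable torsionFreeCentre D-equivariant (xs , covers) (proj₁ modCentre) (proj₂ modCentre)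
    where
    open Equivariant D-equivariant
    open Tame tame
    open Centre H using (≈⇒≈ᶻ)
    modCentre = equivariant⇒constant n S (generators-modCentre T) (tame-modCentre tame)
      (record { cong = ≈⇒≈ᶻ ∘ cong
              ; step = λ x → step x >>= λ (ρ , π , st) → pure (ρ , π , ≈⇒≈ᶻ ∘ st) })
      (xs , λ x → covers x >>= λ p → pure (Any.map ≈⇒≈ᶻ p))

  -- Isomorphisms of Cayley graphs

  -- The permutation matching the edges at a vertex may vary with the vertex. Matching indices
  -- instead of generators keeps multiplicities intact in the quotients by the centres.
  record GraphIso {k} {G : Group c ℓ} {H : Group c₂ ℓ₂} (S : Generators k G) (T : Generators k H) :
                  Set (c ⊔ ℓ ⊔ c₂ ⊔ ℓ₂ ⊔ r) where
    private
      module G = Group G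
      module H = Group H
      module S = Generators S
      module T = Generators T
    field
      to        : G.Carrier → H.Carrier
      from      : H.Carrier → G.Carrier
      to-cong   : ∀ {x y} → x G.≈ y → to x H.≈ to y
      from-cong : ∀ {x y} → x H.≈ y → from x G.≈ from y
      to-from   : ∀ y → to (from y) H.≈ y
      from-to   : ∀ x → from (to x) G.≈ x
      to-ε      : to G.ε H.≈ H.ε
      local     : ∀ x → K (∃ λ (π : Permutation′ k) → ∀ i →
                    to (x G.∙ S.gen i) H.≈ to x H.∙ T.gen (π ⟨$⟩ʳ i))

  flip : ∀ {k} {G : Group c ℓ} {H : Group c₂ ℓ₂} {S : Generators k G} {T : Generators k H} →
         GraphIso S T → GraphIso T S
  flip {k = k} {G = G} {H = H} {S} {T} φ = record
    { to        = from
    ; from      = to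
    ; to-cong   = from-cong
    ; from-cong = to-cong
    ; to-from   = from-to
    ; from-to   = to-from
    ; to-ε      = G.trans (from-cong (H.sym to-ε)) (from-to G.ε)
    ; local     = λ y → local (from y) >>= λ (π , st) → pure (Perm.flip π , back y π st)
    }
    where
    open GraphIso φ
    module G = Group G
    module H = Group H
    module S = Generators S
    module T = Generators T
    back : ∀ y (π : Permutation′ k) →
      (∀ i → to (from y G.∙ S.gen i) H.≈ to (from y) H.∙ T.gen (π ⟨$⟩ʳ i)) →
      ∀ j → from (y H.∙ T.gen j) G.≈ from y G.∙ S.gen (π ⟨$⟩ˡ j)
    back y π st j = begin
      from (y H.∙ T.gen j)                                  ≡⟨ ≡.cong (λ j → from (y H.∙ T.gen j)) (Perm.inverseʳ π) ⟨
      from (y H.∙ T.gen (π ⟨$⟩ʳ (π ⟨$⟩ˡ j)))                ≈⟨ from-cong (H.∙-congʳ (to-from y)) ⟨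
      from (to (from y) H.∙ T.gen (π ⟨$⟩ʳ (π ⟨$⟩ˡ j)))      ≈⟨ from-cong (st (π ⟨$⟩ˡ j)) ⟨
      from (to (from y G.∙ S.gen (π ⟨$⟩ˡ j)))               ≈⟨ from-to _ ⟩
      from y G.∙ S.gen (π ⟨$⟩ˡ j)                           ∎
      where open SetoidReasoning G.setoid

  -- Each attained value in the list is replaced by a point attaining it; excluded middle discards
  -- the others.
  attainedValues : {X : Set a} (H : Group c ℓ) → let open Group H in (D : X → Carrier) (ys : List Carrier) →
    K (∃ λ xs → ∀ x → Any (D x ≈_) ys → K (Any (λ x′ → D x ≈ D x′) xs))
  attainedValues H D []       = pure ([] , λ _ ())
  attainedValues H D (y ∷ ys) = do
    xs , xs-cover ← attainedValues H D ys
    inj₁ (x₀ , Dx₀≈y) ← excludedMiddle (∃ λ x → D x ≈ y)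
      where inj₂ unattained → pure (xs , λ { x (here Dx≈y) → abort (unattained (x , Dx≈y))
                                           ; x (there p)   → xs-cover x p })
    pure (x₀ ∷ xs , λ { x (here Dx≈y) → pure (here (trans Dx≈y (sym Dx₀≈y)))
                      ; x (there p)   → xs-cover x p >>= λ q → pure (there q) })
    where open Group H

  -- Displacements of a graph isomorphism

  module _ {k} {G : Group c ℓ} {H : Group c₂ ℓ₂} {S : Generators k G} {T : Generators k H}
           (φ : GraphIso S T) where
    private
      module G = Group G
      module S = Generators S
    open Group H
    open Generators T using () renaming (gen to t)
    open GraphIso φ
    open GroupSolver H
    open SetoidReasoning setoid
    open Centre H using (_≈ᶻ_; ≈ᶻ⇒central; central⇒≈ᶻ; central-resp)

    -- Used in two cases: h = ε with g central measures the effect of a central translation, and h =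
    -- φ g measures the failure of φ to be multiplicative.
    displacement : Carrier → G.Carrier → G.Carrier → Carrier
    displacement h g x = (h ∙ to x) ⁻¹ ∙ to (g G.∙ x)

    displacement-step : ∀ h g x i {u v} →
      to (x G.∙ S.gen i) ≈ to x ∙ u → to (g G.∙ x G.∙ S.gen i) ≈ to (g G.∙ x) ∙ v →
      u ∙ displacement h g (x G.∙ S.gen i) ≈ displacement h g x ∙ v
    displacement-step h g x i {u} {v} x-step gx-step = begin
      u ∙ ((h ∙ to (x G.∙ S.gen i)) ⁻¹ ∙ to (g G.∙ (x G.∙ S.gen i)))
        ≈⟨ ∙-congˡ (∙-cong (⁻¹-cong (∙-congˡ x-step)) (trans (to-cong (G.sym (G.assoc g x _))) gx-step)) ⟩
      u ∙ ((h ∙ (to x ∙ u)) ⁻¹ ∙ (to (g G.∙ x) ∙ v))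
        ≈⟨ solve 5 (λ h x gx u v → u ⊕ (⊝ (h ⊕ (x ⊕ u)) ⊕ (gx ⊕ v)) ⊜ ⊝ (h ⊕ x) ⊕ gx ⊕ v) refl h _ _ u v ⟩
      (h ∙ to x) ⁻¹ ∙ to (g G.∙ x) ∙ v ∎

    displacement-equivariant : ∀ h g → Equivariant S T (displacement h g)
    displacement-equivariant h g = record
      { cong = λ x≈y → ∙-cong (⁻¹-cong (∙-congˡ (to-cong x≈y))) (to-cong (G.∙-congˡ x≈y))
      ; step = λ x → do
          ρ , x-step  ← local x
          π , gx-step ← local (g G.∙ x)
          pure (ρ , π , λ i → displacement-step h g x i (x-step i) (gx-step i))
      }

    -- A walk spelled by `w` is mapped to a walk of the same length, so the quotient is a product of
    -- as many generators of H, for which there are finitely many choices.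
    rightTranslation-finite : ∀ w → ∃ λ ys → ∀ x → K (Any ((to x) ⁻¹ ∙ to (x G.∙ word G S.gen w) ≈_) ys)
    rightTranslation-finite [] = ε ∷ [] , λ x → pure (here (begin
      to x ⁻¹ ∙ to (x G.∙ G.ε)   ≈⟨ ∙-congˡ (to-cong (G.identityʳ x)) ⟩
      to x ⁻¹ ∙ to x             ≈⟨ inverseˡ (to x) ⟩
      ε                          ∎))
    rightTranslation-finite (i ∷ w) with ys , covers ← rightTranslation-finite w =
      cartesianProductWith _∙_ ys (tabulate t) , λ x → do
        p      ← covers x
        π , st ← local (x G.∙ word G S.gen w)
        pure (Any.map (trans (begin
            to x ⁻¹ ∙ to (x G.∙ (word G S.gen w G.∙ S.gen i))
              ≈⟨ ∙-congˡ (trans (to-cong (G.sym (G.assoc x _ _))) (st i)) ⟩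
            to x ⁻¹ ∙ (to (x G.∙ word G S.gen w) ∙ t (π ⟨$⟩ʳ i))
              ≈⟨ assoc _ _ _ ⟨
            to x ⁻¹ ∙ to (x G.∙ word G S.gen w) ∙ t (π ⟨$⟩ʳ i) ∎))
          (∈-cartesianProductWith⁺ setoid setoid setoid ∙-cong p (Any.tabulate⁺ (π ⟨$⟩ʳ i) refl)))

    -- Left and right translation by a central z agree, so its displacement takes finitely many
    -- values and `equivariant⇒constant` applies.
    centralTranslation : ∀ {n} → Tame n H → ∀ {z} → Central G z →
      K (∃ λ d → Central H d × ∀ x → to (z G.∙ x) ≈ to x ∙ d)
    centralTranslation {n} tame {z} z-central = do
      w , z≈w ← S.generates z
      let ys , covers = rightTranslation-finite w
      xs , xs-cover ← attainedValues H (displacement ε z) ys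
      let const , central = equivariant⇒constant n S T tame (displacement-equivariant ε z)
            (xs , λ x → covers x >>= λ p → xs-cover x (Any.map (trans (∙-cong
              (⁻¹-cong (identityˡ _))
              (to-cong (G.trans (z-central x) (G.∙-congˡ z≈w))))) p))
      pure (displacement ε z G.ε , central , λ x → begin
        to (z G.∙ x)                       ≈⟨ solve 2 (λ x zx → zx ⊜ x ⊕ (⊝ (∅ ⊕ x) ⊕ zx)) refl (to x) _ ⟩
        to x ∙ displacement ε z x          ≈⟨ ∙-congˡ (const x) ⟩
        to x ∙ displacement ε z G.ε        ∎)

    centralDifference : ∀ {x y} → Centre._≈ᶻ_ G x y → ∃ λ z → Central G z × y G.≈ z G.∙ x
    centralDifference {x} {y} x≈y = x G.⁻¹ G.∙ y , Centre.≈ᶻ⇒central G x≈y ,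
      G.sym (G.trans (Centre.≈ᶻ⇒central G x≈y x) (\\-leftDividesˡ x y))
      where open import Algebra.Properties.Group G using (\\-leftDividesˡ)

    to-≈ᶻ : ∀ {n} → Tame n H → ∀ {x y} → Centre._≈ᶻ_ G x y → to x ≈ᶻ to y
    to-≈ᶻ tame {x} {y} x≈y g = Tame.stable tame (do
      let z , z-central , y≈zx = centralDifference x≈y
      d , d-central , to-z ← centralTranslation tame z-central
      pure (central⇒≈ᶻ (central-resp (begin
        d                         ≈⟨ solve 2 (λ x d → d ⊜ ⊝ x ⊕ (x ⊕ d)) refl (to x) d ⟩
        to x ⁻¹ ∙ (to x ∙ d)      ≈⟨ ∙-congˡ (to-z x) ⟨
        to x ⁻¹ ∙ to (z G.∙ x)    ≈⟨ ∙-congˡ (to-cong y≈zx) ⟨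
        to x ⁻¹ ∙ to y            ∎) d-central) g))

    -- Replacing x by zx with z central multiplies both φ x and φ (gx) by the same central d, which
    -- cancels.
    displacement-≈ᶻ : ∀ {n} → Tame n H → ∀ {h g} → (∀ x → Central H (displacement h g x)) →
      ∀ {x y} → Centre._≈ᶻ_ G x y → displacement h g x ≈ displacement h g y
    displacement-≈ᶻ tame {h} {g} D-central {x} {y} x≈y = Tame.stable tame (do
      let z , z-central , y≈zx = centralDifference x≈y
      d , d-central , to-z ← centralTranslation tame z-central
      pure (begin
        D x                                         ≈⟨ solve 2 (λ u d → u ⊜ ⊝ d ⊕ (d ⊕ u)) refl (D x) d ⟩
        d ⁻¹ ∙ (d ∙ D x)                            ≈⟨ ∙-congˡ (d-central (D x)) ⟩
        d ⁻¹ ∙ (D x ∙ d)                            ≈⟨ solve 4 (λ h x gx d → ⊝ d ⊕ (⊝ (h ⊕ x) ⊕ gx ⊕ d) ⊜ ⊝ (h ⊕ (x ⊕ d)) ⊕ (gx ⊕ d)) refl h _ _ d ⟩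
        (h ∙ (to x ∙ d)) ⁻¹ ∙ (to (g G.∙ x) ∙ d)    ≈⟨ ∙-cong (⁻¹-cong (∙-congˡ (to-z x))) (to-z (g G.∙ x)) ⟨
        (h ∙ to (z G.∙ x)) ⁻¹ ∙ to (z G.∙ (g G.∙ x))
          ≈⟨ ∙-congˡ (to-cong (G.trans (G.sym (G.assoc z g x)) (G.trans (G.∙-congʳ (z-central g)) (G.assoc g z x)))) ⟩
        displacement h g (z G.∙ x)                  ≈⟨ Equivariant.cong (displacement-equivariant h g) y≈zx ⟨
        D y                                         ∎))
      where D = displacement h g

    iso-modCentre : ∀ {n} → Tame n H → (∀ {x y} → x ≈ᶻ y → Centre._≈ᶻ_ G (from x) (from y)) →
                    GraphIso (generators-modCentre S) (generators-modCentre T)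
    iso-modCentre tame from-≈ᶻ = record
      { to        = to
      ; from      = from
      ; to-cong   = to-≈ᶻ tame
      ; from-cong = from-≈ᶻ
      ; to-from   = Centre.≈⇒≈ᶻ H ∘ to-from
      ; from-to   = Centre.≈⇒≈ᶻ G ∘ from-to
      ; to-ε      = Centre.≈⇒≈ᶻ H to-ε
      ; local     = λ x → local x >>= λ (π , st) → pure (π , λ i → Centre.≈⇒≈ᶻ H (st i))
      }

    module _ {n} (tame : Tame n H) (from-≈ᶻ : ∀ {x y} → x ≈ᶻ y → Centre._≈ᶻ_ G (from x) (from y))
             (to-homo-≈ᶻ : ∀ g x → to (g G.∙ x) ≈ᶻ to g ∙ to x) where

      -- Multiplicativity modulo the centre makes the defect `D` central. It is trivial at ε, and it
      -- is shown not to change along any edge.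
      homo-from-modCentre : ∀ g x → to (g G.∙ x) ≈ to g ∙ to x
      homo-from-modCentre g x = stable (do
        Dx≈ε ← S.walk {P = λ x → D x ≈ ε} (λ x≈y → trans (D.cong (G.sym x≈y))) {G.ε} Dε≈ε
                 (λ x i Dx≈ε → trans (D-step x i) Dx≈ε) x
        pure (begin
          to (g G.∙ x)              ≈⟨ solve 2 (λ u v → v ⊜ u ⊕ (⊝ u ⊕ v)) refl (to g ∙ to x) _ ⟩
          to g ∙ to x ∙ D x         ≈⟨ ∙-congˡ Dx≈ε ⟩
          to g ∙ to x ∙ ε           ≈⟨ identityʳ _ ⟩
          to g ∙ to x               ∎))
        where
        open Tame tame
        open CentralLemmas H stable torsionFreeCentre
        module Z = AbelianGroup (centre H)
        D = displacement (to g) g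
        module D = Equivariant (displacement-equivariant (to g) g)

        D-central : ∀ x → Central H (D x)
        D-central x = ≈ᶻ⇒central (Group.sym (ModCentre H) (to-homo-≈ᶻ g x))

        Dε≈ε : D G.ε ≈ ε
        Dε≈ε = begin
          (to g ∙ to G.ε) ⁻¹ ∙ to (g G.∙ G.ε)   ≈⟨ ∙-cong (⁻¹-cong (∙-congˡ to-ε)) (to-cong (G.identityʳ g)) ⟩
          (to g ∙ ε) ⁻¹ ∙ to g                  ≈⟨ solve 1 (λ u → ⊝ (u ⊕ ∅) ⊕ u ⊜ ∅) refl (to g) ⟩
          ε                                     ∎

        D-step : ∀ x i → D (x G.∙ S.gen i) ≈ D x
        D-step x i = stable (do
          ρ , x-step  ← local x
          π , gx-step ← local (g G.∙ x)
          pure (constant ρ π (λ i → x-step i) (λ i → gx-step i) i))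
          where
          constant : (ρ π : Permutation′ k) →
            (∀ i → to (x G.∙ S.gen i) ≈ to x ∙ t (ρ ⟨$⟩ʳ i)) →
            (∀ i → to (g G.∙ x G.∙ S.gen i) ≈ to (g G.∙ x) ∙ t (π ⟨$⟩ʳ i)) →
            ∀ i → D (x G.∙ S.gen i) ≈ D x
          constant ρ π x-step gx-step i = x∙y⁻¹≈ε⇒x≈y _ _ (begin
            D (x G.∙ S.gen i) ∙ D x ⁻¹
              ≡⟨ ≡.cong (λ i → D (x G.∙ S.gen i) ∙ D x ⁻¹) (Perm.inverseˡ ρ) ⟨
            proj₁ (δ (ρ ⟨$⟩ʳ i))
              ≈⟨ centralShift-trivial t σ δ t-σ δ-σ (ρ ⟨$⟩ʳ i) ⟩
            ε ∎)
            where
            open import Algebra.Properties.Group H using (x∙y⁻¹≈ε⇒x≈y)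

            neighbour : Fin k → G.Carrier
            neighbour j = x G.∙ S.gen (ρ ⟨$⟩ˡ j)

            to-neighbour : ∀ j → to (neighbour j) ≈ to x ∙ t j
            to-neighbour j = trans (x-step (ρ ⟨$⟩ˡ j)) (reflexive (≡.cong (λ j → to x ∙ t j) (Perm.inverseʳ ρ)))

            -- Comparing the edges at x with those at gx gives t (σ j) = t j δ j, where δ j is the
            -- increment of `D` along the edge with image t j.
            σ : Fin k → Fin k
            σ j = π ⟨$⟩ʳ (ρ ⟨$⟩ˡ j)

            Dᶻ : G.Carrier → Z.Carrier
            Dᶻ y = D y , D-central y

            δ : Fin k → Z.Carrier
            δ j = Dᶻ (neighbour j) Z.∙ Dᶻ x Z.⁻¹

            t-σ : ∀ j → t (σ j) ≈ t j ∙ (D (neighbour j) ∙ D x ⁻¹)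
            t-σ j = begin
              t (σ j)                                ≈⟨ solve 2 (λ u v → v ⊜ v ⊕ u ⊕ ⊝ u) refl (D x) (t (σ j)) ⟩
              t (σ j) ∙ D x ∙ D x ⁻¹                 ≈⟨ ∙-congʳ (D-central x _) ⟨
              D x ∙ t (σ j) ∙ D x ⁻¹                 ≈⟨ ∙-congʳ (displacement-step (to g) g x (ρ ⟨$⟩ˡ j)
                                                          (to-neighbour j) (gx-step (ρ ⟨$⟩ˡ j))) ⟨
              t j ∙ D (neighbour j) ∙ D x ⁻¹         ≈⟨ assoc _ _ _ ⟩
              t j ∙ (D (neighbour j) ∙ D x ⁻¹)       ∎

            tσ≈t : ∀ j → t j ≈ᶻ t (σ j)
            tσ≈t j = central⇒≈ᶻ (central-resp (begin
              proj₁ (δ j)                    ≈⟨ solve 2 (λ u v → v ⊜ ⊝ u ⊕ (u ⊕ v)) refl (t j) _ ⟩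
              t j ⁻¹ ∙ (t j ∙ proj₁ (δ j))   ≈⟨ ∙-congˡ (t-σ j) ⟨
              t j ⁻¹ ∙ t (σ j)               ∎) (proj₂ (δ j)))

            -- Since t j and t (σ j) agree modulo the centre, so do the images of the two
            -- neighbours, and the inverse isomorphism carries this congruence back to G.
            neighbour-σ : ∀ j → Centre._≈ᶻ_ G (neighbour (σ j)) (neighbour j)
            neighbour-σ j = G/Z.trans (Centre.≈⇒≈ᶻ G (G.sym (from-to _)))
              (G/Z.trans (from-≈ᶻ (H/Z.trans (Centre.≈⇒≈ᶻ H (to-neighbour (σ j)))
                 (H/Z.trans (H/Z.∙-congˡ (H/Z.sym (tσ≈t j))) (Centre.≈⇒≈ᶻ H (sym (to-neighbour j))))))
                 (Centre.≈⇒≈ᶻ G (from-to _)))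
              where
              module G/Z = Group (ModCentre G)
              module H/Z = Group (ModCentre H)

            δ-σ : ∀ j → δ (σ j) Z.≈ δ j
            δ-σ j = ∙-congʳ (displacement-≈ᶻ tame D-central (neighbour-σ j))

  -- Both groups pass to the quotient together: φ induces an isomorphism of quotients only if its
  -- inverse descends too, which is `to-≈ᶻ` for the flipped isomorphism.
  graphIso⇒homo : ∀ n {k} {G : Group c ℓ} {H : Group c₂ ℓ₂} {S : Generators k G} {T : Generators k H} →
    Tame n G → Tame n H → (φ : GraphIso S T) → let open GraphIso φ in
    ∀ g x → Group._≈_ H (to (Group._∙_ G g x)) (Group._∙_ H (to g) (to x))
  graphIso⇒homo zero {H = H} G-tame H-tame φ g x = trans (trivial _) (sym (trivial _))
    where
    open Group H
    trivial = Tame.upperNilpotent H-tame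
  graphIso⇒homo (suc n) G-tame H-tame φ =
    homo-from-modCentre φ H-tame from-≈ᶻ
      (graphIso⇒homo n (tame-modCentre G-tame) (tame-modCentre H-tame) (iso-modCentre φ H-tame from-≈ᶻ))
    where
    from-≈ᶻ = λ {x} {y} → to-≈ᶻ (flip φ) G-tame {x} {y}

  -- Passage to stable equality and to enumerated generators

  -- Equality is replaced by its closure under `K`, which makes it stable since `K` is a monad.
  stabilise : Group c ℓ → Group c (ℓ ⊔ r)
  stabilise G = coarsen G {_~_ = λ x y → K (x ≈ y)} (record
    { isMonoid = record
      { isSemigroup = record
        { isMagma = record
          { isEquivalence = record
            { refl  = pure refl
            ; sym   = λ p → p >>= λ x≈y → pure (sym x≈y)
            ; trans = λ p q → p >>= λ x≈y → q >>= λ y≈z → pure (trans x≈y y≈z)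
            }
          ; ∙-cong = λ p q → p >>= λ x≈y → q >>= λ u≈v → pure (∙-cong x≈y u≈v)
          }
        ; assoc = λ x y z → pure (assoc x y z)
        }
      ; identity = (λ x → pure (identityˡ x)) , (λ x → pure (identityʳ x))
      }
    ; inverse = (λ x → pure (inverseˡ x)) , (λ x → pure (inverseʳ x))
    ; ⁻¹-cong = λ p → p >>= λ x≈y → pure (⁻¹-cong x≈y)
    })
    where open Group G

  tame-stabilise : ∀ m (G : Group c ℓ) → TorsionFree G → ((n , _) : Nilpotent G) → Tame (m ℕ.+ n) (stabilise G)
  tame-stabilise m G torsionFree (n , γ⇒ε) = record
    { stable            = λ p → p >>= λ q → q
    ; torsionFreeCentre = torsionFree⇒torsionFreeCentre (stabilise G) λ g n gⁿ≈ε → do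
        gⁿ≈ε′ ← gⁿ≈ε
        pure (torsionFree g n (trans
          (reflexive (pow-map G (stabilise G) (λ x → x) ≡.refl (λ _ _ → ≡.refl) g (suc n))) gⁿ≈ε′))
    ; upperNilpotent    = upperNilpotent-+ m n (stabilise G)
        (γ-trivial⇒upperNilpotent n (stabilise G) λ x γx → do
          let y , γy , y~x = γ-coarsen G (Group.isGroup (stabilise G)) n γx
          y≈x ← y~x
          pure (trans (sym y≈x) (γ⇒ε y γy)))
    }
    where open Group G

  bijectiveRelation⇒permutation : ∀ {k} (P : Fin k → Fin k → Set a) →
    (∀ i → K (∃ λ j → P i j)) → (∀ j → K (∃ λ i → P i j)) →
    (∀ {i j j′} → P i j → P i j′ → K (j ≡ j′)) → (∀ {i i′ j} → P i j → P i′ j → K (i ≡ i′)) →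
    K (∃ λ (π : Permutation′ k) → ∀ i → P i (π ⟨$⟩ʳ i))
  bijectiveRelation⇒permutation P total surjective functional injective = do
    f ← finiteChoice total
    g ← finiteChoice surjective
    fg ← finiteChoice λ j → functional (proj₂ (f (proj₁ (g j)))) (proj₂ (g j))
    gf ← finiteChoice λ i → injective (proj₂ (g (proj₁ (f i)))) (proj₂ (f i))
    pure (Perm.permutation (proj₁ ∘ f) (proj₁ ∘ g) fg gf , proj₂ ∘ f)

  record Enumeration (G : Group c ℓ) (S : Group.Carrier G → Set a) (k : ℕ) : Set (a ⊔ c ⊔ ℓ ⊔ r) where
    open Group G
    field
      elem      : Fin k → Carrier
      elem∈S    : ∀ i → S (elem i)
      covers    : ∀ {x} → S x → K (∃ λ i → x ≈ elem i)
      injective : ∀ {i j} → elem i ≈ elem j → K (i ≡ j)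

  -- The list may contain elements outside S and repetitions; excluded middle, with R for falsity,
  -- removes both.
  enumerate : (G : Group c ℓ) → let open Group G in {S : Carrier → Set a} →
    (∀ {x y} → x ≈ y → S x → S y) → FiniteSubset G S → K (∃ (Enumeration G S))
  enumerate {a = a} G {S} S-resp (ys , S⊆ys) = do
    k , E ← go ys
    pure (k , record { elem = elem E ; elem∈S = λ i → proj₁ (elem∈S E i) ; injective = injective E
                     ; covers = λ x∈S → covers E (x∈S , S⊆ys _ x∈S) })
    where
    open Group G
    open Enumeration
    Sₗ : List Carrier → Carrier → Set _
    Sₗ ys x = S x × Any (x ≈_) ys

    go : ∀ ys → K (∃ (Enumeration G (Sₗ ys)))
    go [] = pure (0 , record { elem = λ () ; elem∈S = λ () ; covers = λ () ; injective = λ { {()} } })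
    go (y ∷ ys) = do
      k , E ← go ys
      let weaken = λ i → proj₁ (elem∈S E i) , there (proj₂ (elem∈S E i))
      inj₁ y∈S ← excludedMiddle (S y)
        where inj₂ y∉S → pure (k , record
                { elem = elem E ; elem∈S = weaken ; injective = injective E
                ; covers = λ { (x∈S , here x≈y) → abort (y∉S (S-resp x≈y x∈S))
                             ; (x∈S , there p)  → covers E (x∈S , p) } })
      inj₂ new ← excludedMiddle (∃ λ i → y ≈ elem E i)
        where inj₁ (i , y≈eᵢ) → pure (k , record
                { elem = elem E ; elem∈S = weaken ; injective = injective E
                ; covers = λ { (x∈S , here x≈y) → pure (i , trans x≈y y≈eᵢ)
                             ; (x∈S , there p)  → covers E (x∈S , p) } })
      pure (suc k , record
        { elem      = λ { zero → y ; (suc i) → elem E i }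
        ; elem∈S    = λ { zero → y∈S , here refl ; (suc i) → weaken i }
        ; covers    = λ { (_   , here x≈y) → pure (zero , x≈y)
                        ; (x∈S , there p)  → covers E (x∈S , p) >>= λ (i , x≈eᵢ) → pure (suc i , x≈eᵢ) }
        ; injective = λ { {zero}  {zero}  _     → pure ≡.refl
                        ; {zero}  {suc j} y≈eⱼ  → abort (new (j , y≈eⱼ))
                        ; {suc i} {zero}  eᵢ≈y  → abort (new (i , sym eᵢ≈y))
                        ; {suc i} {suc j} eᵢ≈eⱼ → injective E eᵢ≈eⱼ >>= λ eq → pure (≡.cong suc eq) }
        })

  opposites : {G : Group c ℓ} → let open Group G in {S : Carrier → Set a} {k : ℕ} →
    SymmetricSubset G S → (E : Enumeration G S k) → let open Enumeration E in
    K (∃ λ (ι : Permutation′ k) → ∀ i → elem (ι ⟨$⟩ʳ i) ≈ elem i ⁻¹)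
  opposites {G = G} S-symmetric E = bijectiveRelation⇒permutation (λ i j → elem j ≈ elem i ⁻¹)
    (λ i → covers (symmetric (elem∈S i)) >>= λ (j , p) → pure (j , sym p))
    (λ j → covers (symmetric (elem∈S j)) >>= λ (i , p) → pure (i , trans (sym (⁻¹-involutive _)) (⁻¹-cong p)))
    (λ p q → injective (trans p (sym q)))
    (λ p q → injective (⁻¹-injective (trans (sym p) q)))
    where
    open Group G
    open Enumeration E
    open SymmetricSubset S-symmetric
    open import Algebra.Properties.Group G using (⁻¹-involutive; ⁻¹-injective)

  connected⇒generated : {G : Group c ℓ} → let open Group G in {S : Carrier → Set a} {k : ℕ} →
    Connected G S → (E : Enumeration G S k) → let open Enumeration E in
    ∀ x → K (∃ λ w → x ≈ word G elem w)
  connected⇒generated {G = G} {S} connected E x = along [] refl (connected ε x)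
    where
    open Group G
    open Enumeration E
    along : ∀ w {a} → a ≈ word G elem w → Star (λ a b → a ≈ b ⊎ GroupNotions.CayAdj G S a b) a x →
            K (∃ λ w → x ≈ word G elem w)
    along w a≈w []                                 = pure (w , a≈w)
    along w a≈w (inj₁ a≈b ◅ path)                  = along w (trans (sym a≈b) a≈w) path
    along w a≈w (inj₂ (s , s∈S , b≈as) ◅ path) = do
      i , s≈eᵢ ← covers s∈S
      along (i ∷ w) (trans b≈as (∙-cong a≈w s≈eᵢ)) path

-- Normalisation and conclusion

module _ (G₁ : Group c ℓ) (G₂ : Group c₂ ℓ₂) {S₁ : Group.Carrier G₁ → Set a} {S₂ : Group.Carrier G₂ → Set b}
         (φ : CayleyIso G₁ G₂ S₁ S₂) where
  private
    module G₁ = Group G₁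
    module φ = Inverse (proj₁ φ)
  open Group G₂
  open GroupSolver G₂

  -- Left translations are automorphisms of a Cayley graph, so φ may be followed by the one that
  -- returns φ ε to ε.
  normalise : CayleyIso G₁ G₂ S₁ S₂
  normalise = record
    { to        = λ x → φ.to G₁.ε ⁻¹ ∙ φ.to x
    ; from      = λ y → φ.from (φ.to G₁.ε ∙ y)
    ; to-cong   = λ x≈y → ∙-congˡ (φ.to-cong x≈y)
    ; from-cong = λ x≈y → φ.from-cong (∙-congˡ x≈y)
    ; inverse   = (λ {y} x≈ → trans (∙-congˡ (φ.inverseˡ x≈)) (solve 2 (λ u y → ⊝ u ⊕ (u ⊕ y) ⊜ y) refl _ y))
                , (λ {x} y≈ → φ.inverseʳ (trans (∙-congˡ y≈) (solve 2 (λ u y → u ⊕ (⊝ u ⊕ y) ⊜ y) refl _ (φ.to x))))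
    } , λ x y → mk⇔
      (λ adj → let s , s∈S , p = Equivalence.to (proj₂ φ x y) adj in
        s , s∈S , trans (∙-congˡ p) (sym (assoc _ _ _)))
      (λ (s , s∈S , p) → Equivalence.from (proj₂ φ x y)
        (s , s∈S , ∙-cancelˡ (φ.to G₁.ε ⁻¹) _ _ (trans p (assoc _ _ _))))
    where open import Algebra.Properties.Group G₂ using (∙-cancelˡ)

module _ (G₁ : Group c ℓ) (G₂ : Group c₂ ℓ₂)
         (torsionFree₁ : TorsionFree G₁) (nilpotent₁ : Nilpotent G₁)
         (torsionFree₂ : TorsionFree G₂) (nilpotent₂ : Nilpotent G₂)
         {S₁ : Group.Carrier G₁ → Set a} (S₁-symmetric : SymmetricSubset G₁ S₁)
         (S₁-connected : Connected G₁ S₁) (S₁-finite : FiniteSubset G₁ S₁)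
         {S₂ : Group.Carrier G₂ → Set b} (S₂-symmetric : SymmetricSubset G₂ S₂)
         (φ : CayleyIso G₁ G₂ S₁ S₂)
         (to-ε : Group._≈_ G₂ (Inverse.to (proj₁ φ) (Group.ε G₁)) (Group.ε G₂)) where
  open Inverse (proj₁ φ) using (to; from)
  private
    module G₁ = Group G₁
    module S₂ = SymmetricSubset S₂-symmetric
    module φ = Inverse (proj₁ φ)
  open Group G₂
  open import Algebra.Properties.Group G₂ using (∙-cancelˡ)
  open import Algebra.Properties.Group G₁ using () renaming (∙-cancelˡ to G₁-cancelˡ)

  normalisedIso-homo : ∀ g x → to (g G₁.∙ x) ≈ to g ∙ to x
  -- With `R` the goal itself, chosen anew for each g and x, the identity continuation extracts the
  -- equation.
  normalisedIso-homo g x = homo (λ eq → eq)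
    where
    open Relative (to (g G₁.∙ x) ≈ to g ∙ to x)

    to-from : ∀ y → to (from y) ≈ y
    to-from y = φ.inverseˡ G₁.refl

    from-to : ∀ x → from (to x) G₁.≈ x
    from-to x = φ.inverseʳ refl

    to-injective : ∀ {x y} → to x ≈ to y → x G₁.≈ y
    to-injective p = G₁.trans (G₁.sym (from-to _)) (φ.inverseʳ p)

    module Enumerated {k} (E₁ : Enumeration G₁ S₁ k) where
      module E₁ = Enumeration E₁

      forward : ∀ x i → ∃ λ u → S₂ u × to (x G₁.∙ E₁.elem i) ≈ to x ∙ u
      forward x i = Equivalence.to (proj₂ φ x _) (E₁.elem i , E₁.elem∈S i , G₁.refl)

      backward : ∀ x u → S₂ u → K (∃ λ i → to (x G₁.∙ E₁.elem i) ≈ to x ∙ u)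
      backward x u u∈S₂ = do
        let s , s∈S₁ , p = Equivalence.from (proj₂ φ x (from (to x ∙ u))) (u , u∈S₂ , to-from _)
        i , s≈eᵢ ← E₁.covers s∈S₁
        pure (i , trans (φ.to-cong (G₁.sym (G₁.trans p (G₁.∙-congˡ s≈eᵢ)))) (to-from _))

      atε : ∀ {i u} → to (G₁.ε G₁.∙ E₁.elem i) ≈ to G₁.ε ∙ u → to (E₁.elem i) ≈ u
      atε p = trans (φ.to-cong (G₁.sym (G₁.identityˡ _))) (trans p (trans (∙-congʳ to-ε) (identityˡ _)))

      -- The neighbours of ε correspond under φ, so S₂ inherits finiteness and an indexing by the
      -- same `Fin k` from S₁.
      E₂ : Enumeration G₂ S₂ k
      E₂ = record
        { elem      = to ∘ E₁.elem
        ; elem∈S    = λ i → let u , u∈S₂ , p = forward G₁.ε i in S₂.respects (sym (atε p)) u∈S₂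
        ; covers    = λ u∈S₂ → backward G₁.ε _ u∈S₂ >>= λ (i , p) → pure (i , sym (atε p))
        ; injective = λ p → E₁.injective (to-injective p)
        }
      module E₂ = Enumeration E₂

      local : ∀ x → K (∃ λ (π : Permutation′ k) → ∀ i →
                to (x G₁.∙ E₁.elem i) ≈ to x ∙ E₂.elem (π ⟨$⟩ʳ i))
      local x = bijectiveRelation⇒permutation (λ i j → to (x G₁.∙ E₁.elem i) ≈ to x ∙ E₂.elem j)
        (λ i → let u , u∈S₂ , p = forward x i in
          E₂.covers u∈S₂ >>= λ (j , u≈eⱼ) → pure (j , trans p (∙-congˡ u≈eⱼ)))
        (λ j → backward x _ (E₂.elem∈S j))
        (λ p q → E₂.injective (∙-cancelˡ _ _ _ (trans (sym p) q)))
        (λ p q → E₁.injective (G₁-cancelˡ _ _ _ (to-injective (trans p (sym q)))))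

      to-word : ∀ w → K (∃ λ w′ → to (word G₁ E₁.elem w) ≈ word G₂ E₂.elem w′)
      to-word []      = pure ([] , to-ε)
      to-word (i ∷ w) = do
        π , step    ← local (word G₁ E₁.elem w)
        w′ , to-w≈w′ ← to-word w
        pure ((π ⟨$⟩ʳ i) ∷ w′ , trans (step i) (∙-congʳ to-w≈w′))

      module _ {ι₁ ι₂ : Permutation′ k} (ι₁-opp : ∀ i → E₁.elem (ι₁ ⟨$⟩ʳ i) G₁.≈ E₁.elem i G₁.⁻¹)
               (ι₂-opp : ∀ i → E₂.elem (ι₂ ⟨$⟩ʳ i) ≈ E₂.elem i ⁻¹) where

        generators₁ : Generators k (stabilise G₁)
        generators₁ = record
          { gen       = E₁.elem
          ; opp       = ι₁
          ; gen-opp   = λ i → pure (ι₁-opp i)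
          ; generates = λ x → do
              w , x≈w ← connected⇒generated S₁-connected E₁ x
              pure (w , pure x≈w)
          }

        generators₂ : Generators k (stabilise G₂)
        generators₂ = record
          { gen       = E₂.elem
          ; opp       = ι₂
          ; gen-opp   = λ i → pure (ι₂-opp i)
          -- A word for `from y` is carried by φ to one for y, which transports connectedness to the
          -- second graph.
          ; generates = λ y → do
              w , from-y≈w ← connected⇒generated S₁-connected E₁ (from y)
              w′ , to-w≈w′ ← to-word w
              pure (w′ , pure (trans (sym (to-from y)) (trans (φ.to-cong from-y≈w) to-w≈w′)))
          }

        graphIso : GraphIso generators₁ generators₂
        graphIso = record
          { to        = to
          ; from      = from
          ; to-cong   = λ p → p >>= λ x≈y → pure (φ.to-cong x≈y)
          ; from-cong = λ p → p >>= λ x≈y → pure (φ.from-cong x≈y)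
          ; to-from   = λ y → pure (to-from y)
          ; from-to   = λ x → pure (from-to x)
          ; to-ε      = pure to-ε
          ; local     = λ x → local x >>= λ (π , step) → pure (π , λ i → pure (step i))
          }

    homo : K (to (g G₁.∙ x) ≈ to g ∙ to x)
    homo = do
      k , E₁ ← enumerate G₁ (SymmetricSubset.respects S₁-symmetric) S₁-finite
      let open Enumerated E₁
      ι₁ , ι₁-opp ← opposites S₁-symmetric E₁
      ι₂ , ι₂-opp ← opposites S₂-symmetric E₂
      graphIso⇒homo (proj₁ nilpotent₂ ℕ.+ proj₁ nilpotent₁)
        (tame-stabilise (proj₁ nilpotent₂) G₁ torsionFree₁ nilpotent₁)
        (≡.subst (λ n → Tame n (stabilise G₂)) (ℕ.+-comm (proj₁ nilpotent₁) _)
          (tame-stabilise (proj₁ nilpotent₁) G₂ torsionFree₂ nilpotent₂))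
        (graphIso {ι₁} {ι₂} (λ i → ι₁-opp i) (λ i → ι₂-opp i)) g x

theorem1p1 : ∀ {c ℓ c₂ ℓ₂ s s₂ : Level} (G₁ : Group c ℓ) (G₂ : Group c₂ ℓ₂) →
    TorsionFree G₁ → Nilpotent G₁ → TorsionFree G₂ → Nilpotent G₂ →
    (S₁ : Group.Carrier G₁ → Set s) → SymmetricSubset G₁ S₁ →
    Connected G₁ S₁ → FiniteSubset G₁ S₁ →
    (S₂ : Group.Carrier G₂ → Set s₂) → SymmetricSubset G₂ S₂ →
    CayleyIso G₁ G₂ S₁ S₂ →
    GroupIso G₁ G₂
theorem1p1 G₁ G₂ torsionFree₁ nilpotent₁ torsionFree₂ nilpotent₂ S₁ S₁-symmetric S₁-connected S₁-finite
  S₂ S₂-symmetric φ = to , record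
  { isGroupMonomorphism = record
    { isGroupHomomorphism = record
      { isMonoidHomomorphism = record
        { isMagmaHomomorphism = record
          { isRelHomomorphism = record { cong = ψ.to-cong }
          ; homo = to-homo
          }
        ; ε-homo = to-ε
        }
      ; ⁻¹-homo = λ x → inverseˡ-unique _ _
          (trans (sym (to-homo (x G₁.⁻¹) x)) (trans (ψ.to-cong (G₁.inverseˡ x)) to-ε))
      }
    ; injective = λ p → G₁.trans (G₁.sym (ψ.inverseʳ refl)) (ψ.inverseʳ p)
    }
  ; surjective = λ y → from y , ψ.inverseˡ
  }
  where
  module G₁ = Group G₁
  open Group G₂
  open import Algebra.Properties.Group G₂ using (inverseˡ-unique)
  module ψ = Inverse (proj₁ (normalise G₁ G₂ φ))
  open ψ using (to; from)

  to-ε : to G₁.ε ≈ ε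
  to-ε = inverseˡ _

  to-homo : ∀ g x → to (g G₁.∙ x) ≈ to g ∙ to x
  to-homo = normalisedIso-homo G₁ G₂ torsionFree₁ nilpotent₁ torsionFree₂ nilpotent₂
    S₁-symmetric S₁-connected S₁-finite S₂-symmetric (normalise G₁ G₂ φ) to-ε
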